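{- (Context Lemma) Let $P,Q$ be processes of the $\pi$-calculus such that for every process $R$ and every substitution $\sigma$ one has $(P\sigma \mid R)\ \overset{\bullet}{\leq}_B\ (Q\sigma\mid R)$, where $\overset{\bullet}{\leq}_B$ is strong barbed similarity. Then $P$ and $Q$ are strongly barbed precongruent, i.e. $C[P]\ \overset{\bullet}{\leq}_B\ C[Q]$ for every process context $C$. In other words, $\leq_{\mid s}\ \subseteq\ \leq_B$.
   Context: Syntax. Over an infinite set of names, processes are $P,Q ::= \mathbf 0 \mid x(y).P \mid \bar x y.P \mid (P\mid Q) \mid (\nu x)P \mid\ !P$. Input $x(y).P$ and restriction $(\nu y)P$ bind $y$ in $P$; all other name occurrences are free; processes are identified up to $\alpha$-equivalence; $\mathrm{fn}(P)$ is the set of free names. Actions: $\alpha ::= x(y)\mid \bar x y\mid \bar x(y)\mid\tau$ (input, free output, bound output, internal). In $x(y)$ and $\bar x(y)$ the name $y$ is bound; other occurrences are free. $\mathrm{fn}(\alpha),\mathrm{bn}(\alpha),\mathrm n(\alpha)$ denote free, bound, all names. Convention: in a transition $P\xrightarrow{\alpha}P'$ the bound name of $\alpha$ (if any) is fresh, i.e. $\mathrm{bn}(\alpha)\cap\mathrm{fn}(P)=\emptyset$; it may occur free in $P'$ and is regarded as binding there. Late labelled transition system (least relations closed under): S-In: $x(z).P\xrightarrow{x(z)}P$. S-Out: $\bar xy.P\xrightarrow{\bar xy}P$. S-Par-L: if $P\xrightarrow{\alpha}P'$ and $\mathrm{bn}(\alpha)\cap\mathrm{fn}(Q)=\emptyset$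 then $P\mid Q\xrightarrow{\alpha}P'\mid Q$; S-Par-R: symmetric. S-Com-L: if $P\xrightarrow{\bar xy}P'$ and $Q\xrightarrow{x(z)}Q'$ then $P\mid Q\xrightarrow{\tau}P'\mid Q'\{y/z\}$; S-Com-R: symmetric. S-Res: if $P\xrightarrow{\alpha}P'$ and $z\notin\mathrm n(\alpha)$ then $(\nu z)P\xrightarrow{\alpha}(\nu z)P'$. S-Open: if $P\xrightarrow{\bar xz}P'$ and $z\ne x$ then $(\nu z)P\xrightarrow{\bar x(z)}P'$. S-Close-L: if $P\xrightarrow{\bar x(z)}P'$ and $Q\xrightarrow{x(z)}Q'$ then $P\mid Q\xrightarrow{\tau}(\nu z)(P'\mid Q')$; S-Close-R: symmetric. S-Rep: if $P\xrightarrow{\alpha}P'$ then $!P\xrightarrow{\alpha}P'\mid !P$. S-Rep-Com: if $P\xrightarrow{\bar xy}P'$ and $P\xrightarrow{x(z)}P''$ then $!P\xrightarrow{\tau}(P'\mid P''\{y/z\})\mid !P$. S-Rep-Close: if $P\xrightarrow{\bar x(z)}P'$ and $P\xrightarrow{x(z)}P''$ then $!P\xrightarrow{\tau}((\nu z)(P'\mid P''))\mid !P$. Barbs: $P\downarrow_x$ iff $P\xrightarrow{x(z)}P'$ for some $z,P'$; $P\downarrow_{\bar x}$ iff $P\xrightarrow{\bar xy}P'$ or $P\xrightarrow{\bar x(z)}P'$ for some $y,z,P'$. A strong barbed simulation is a binary relation $\mathcal R$ on processes such that whenever $P\mathbin{\mathcal R}Q$: (1) $P\downarrow_x$ implies $Q\downarrow_x$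 and $P\downarrow_{\bar x}$ implies $Q\downarrow_{\bar x}$, for all names $x$; (2) if $P\xrightarrow{\tau}P'$ then there is $Q'$ with $Q\xrightarrow{\tau}Q'$ and $P'\mathbin{\mathcal R}Q'$. Strong barbed similarity $\overset{\bullet}{\leq}_B$ is the union of all strong barbed simulations. Process contexts: $C ::= [\,\_\,]\mid x(y).C\mid\bar xy.C\mid (C\mid P)\mid(P\mid C)\mid(\nu x)C\mid\ !C$ (exactly one hole); $C[P]$ is the process obtained by replacing the hole by $P$, where binders of $C$ may capture free names of $P$ (contexts are not taken up to $\alpha$-equivalence). Strong barbed precongruence: $P\leq_B Q$ iff $C[P]\ \overset{\bullet}{\leq}_B\ C[Q]$ for every context $C$. Substitutions $\sigma$ are functions from names to names that differ from the identity on only finitely many names; $P\sigma$ denotes capture-avoiding simultaneous replacement of the free names of $P$. $\leq_{\mid s}\ :=\{(P,Q)\mid \text{for all }R,\sigma:\ (P\sigma\mid R)\ \overset{\bullet}{\leq}_B\ (Q\sigma\mid R)\}$. -}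

module Defs where

open import Data.List.Base using (List)
open import Data.List.Membership.Propositional using () renaming (_∉_ to _∉ˡ_)
open import Data.Maybe.Base using (Maybe; just; nothing)
import Data.Maybe.Base as Maybe
open import Data.Product using (Σ-syntax; ∃-syntax; _×_)
open import Data.Sum using (_⊎_)
open import Level using (0ℓ) renaming (suc to ℓsuc)
open import Relation.Binary using (Rel; DecidableEquality)
open import Relation.Binary.PropositionalEquality using (_≡_; _≢_)
open import Relation.Nullary using (does)
open import Relation.Unary using (Pred; _∉_; ∅; ｛_｝; _∪_; _⊢_; _⊥_)
open import Data.Bool.Base using (if_then_else_)

-- An infinite set of names: decidable equality (needed to define substitution)
-- and, for every finite list of names, a name outside it.
record Names : Set₁ where
  field
    Name  : Set
    _≟_   : DecidableEquality Name
    fresh : (xs : List Name) → ∃[ x ] x ∉ˡ xs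

-- α-equivalence classes of processes with free names in V, so that α-equivalence
-- is _≡_: under a binder, `nothing` is the bound name and `just v` is the outer v.
data Proc (V : Set) : Set where
  𝟎    : Proc V
  recv : V → Proc (Maybe V) → Proc V
  send : V → V → Proc V → Proc V
  _∣_  : Proc V → Proc V → Proc V
  ν    : Proc (Maybe V) → Proc V
  !_   : Proc V → Proc V

infixr 5 _∣_
infix  8 !_

-- Simultaneous replacement of free names; it cannot capture, because bound names
-- are not in V.
ren : ∀ {V W : Set} → (V → W) → Proc V → Proc W
ren f 𝟎            = 𝟎
ren f (recv x P)   = recv (f x) (ren (Maybe.map f) P)
ren f (send x y P) = send (f x) (f y) (ren f P)
ren f (P ∣ Q)      = ren f P ∣ ren f Q
ren f (ν P)        = ν (ren (Maybe.map f) P)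
ren f (! P)        = ! ren f P

fn : ∀ {V : Set} → Proc V → Pred V 0ℓ
fn 𝟎            = ∅
fn (recv x P)   = ｛ x ｝ ∪ (just ⊢ fn P)
fn (send x y P) = ｛ x ｝ ∪ ｛ y ｝ ∪ fn P
fn (P ∣ Q)      = fn P ∪ fn Q
fn (ν P)        = just ⊢ fn P
fn (! P)        = fn P

module Calculus (𝒩 : Names) where
  open Names 𝒩

  Process : Set
  Process = Proc Name

  -- The α-class of the abstraction (x)P: every free occurrence of x in P is bound.
  abs : Name → Process → Proc (Maybe Name)
  abs x = ren (λ w → if does (w ≟ x) then nothing else just w)

  infixr 7 _⦅_⦆∙_ _⟨_⟩∙_ ν⟨_⟩_

  _⦅_⦆∙_ : Name → Name → Process → Process
  x ⦅ y ⦆∙ P = recv x (abs y P)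

  _⟨_⟩∙_ : Name → Name → Process → Process
  x ⟨ y ⟩∙ P = send x y P

  ν⟨_⟩_ : Name → Process → Process
  ν⟨ x ⟩ P = ν (abs x P)

  infix 9 _[_/_] _⟪_⟫

  _[_/_] : Process → Name → Name → Process
  P [ y / z ] = ren (λ w → if does (w ≟ z) then y else w) P

  record Subst : Set where
    field
      apply   : Name → Name
      support : List Name
      finite  : ∀ x → x ∉ˡ support → apply x ≡ x

  _⟪_⟫ : Process → Subst → Process
  P ⟪ σ ⟫ = ren (Subst.apply σ) P

  data Action : Set where
    input    : (x y : Name) → Action
    output   : (x y : Name) → Action
    boundOut : (x y : Name) → Action
    τ        : Action

  fnᵃ : Action → Pred Name 0ℓ
  fnᵃ (input x y)    = ｛ x ｝
  fnᵃ (output x y)   = ｛ x ｝ ∪ ｛ y ｝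
  fnᵃ (boundOut x y) = ｛ x ｝
  fnᵃ τ              = ∅

  bn : Action → Pred Name 0ℓ
  bn (input x y)    = ｛ y ｝
  bn (output x y)   = ∅
  bn (boundOut x y) = ｛ y ｝
  bn τ              = ∅

  nᵃ : Action → Pred Name 0ℓ
  nᵃ α = fnᵃ α ∪ bn α

  infix 4 _—[_]→_

  -- The convention bn α ∩ fn P = ∅ for every P —[ α ]→ P′ is imposed in S-In; all
  -- other rules preserve it.  α-conversion needs no rule: a process is of the form
  -- x ⦅ z ⦆∙ P or ν⟨ z ⟩ P for every sufficiently fresh choice of z.
  data _—[_]→_ : Process → Action → Process → Set where
    S-In : ∀ {x z P} → z ∉ fn (x ⦅ z ⦆∙ P) →
           x ⦅ z ⦆∙ P —[ input x z ]→ P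
    S-Out : ∀ {x y P} →
            x ⟨ y ⟩∙ P —[ output x y ]→ P
    S-Par-L : ∀ {α P P′ Q} → P —[ α ]→ P′ → bn α ⊥ fn Q →
              P ∣ Q —[ α ]→ P′ ∣ Q
    S-Par-R : ∀ {α P Q Q′} → Q —[ α ]→ Q′ → bn α ⊥ fn P →
              P ∣ Q —[ α ]→ P ∣ Q′
    S-Com-L : ∀ {x y z P P′ Q Q′} →
              P —[ output x y ]→ P′ → Q —[ input x z ]→ Q′ →
              P ∣ Q —[ τ ]→ P′ ∣ Q′ [ y / z ]
    S-Com-R : ∀ {x y z P P′ Q Q′} →
              P —[ input x z ]→ P′ → Q —[ output x y ]→ Q′ →
              P ∣ Q —[ τ ]→ P′ [ y / z ] ∣ Q′
    S-Res : ∀ {α z P P′} → P —[ α ]→ P′ → z ∉ nᵃ α →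
            ν⟨ z ⟩ P —[ α ]→ ν⟨ z ⟩ P′
    S-Open : ∀ {x z P P′} → P —[ output x z ]→ P′ → z ≢ x →
             ν⟨ z ⟩ P —[ boundOut x z ]→ P′
    S-Close-L : ∀ {x z P P′ Q Q′} →
                P —[ boundOut x z ]→ P′ → Q —[ input x z ]→ Q′ →
                P ∣ Q —[ τ ]→ ν⟨ z ⟩ (P′ ∣ Q′)
    S-Close-R : ∀ {x z P P′ Q Q′} →
                P —[ input x z ]→ P′ → Q —[ boundOut x z ]→ Q′ →
                P ∣ Q —[ τ ]→ ν⟨ z ⟩ (P′ ∣ Q′)
    S-Rep : ∀ {α P P′} → P —[ α ]→ P′ →
            ! P —[ α ]→ P′ ∣ ! P
    S-Rep-Com : ∀ {x y z P P′ P″} →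
                P —[ output x y ]→ P′ → P —[ input x z ]→ P″ →
                ! P —[ τ ]→ (P′ ∣ P″ [ y / z ]) ∣ ! P
    S-Rep-Close : ∀ {x z P P′ P″} →
                  P —[ boundOut x z ]→ P′ → P —[ input x z ]→ P″ →
                  ! P —[ τ ]→ (ν⟨ z ⟩ (P′ ∣ P″)) ∣ ! P

  infix 4 _↓ⁱ_ _↓ᵒ_ _≲_ _≤B_ _≤∣s_

  _↓ⁱ_ : Process → Name → Set
  P ↓ⁱ x = ∃[ z ] ∃[ P′ ] (P —[ input x z ]→ P′)

  _↓ᵒ_ : Process → Name → Set
  P ↓ᵒ x = ∃[ y ] ∃[ P′ ] ((P —[ output x y ]→ P′) ⊎ (P —[ boundOut x y ]→ P′))

  record IsStrongBarbedSimulation (R : Rel Process 0ℓ) : Set where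
    field
      barbⁱ : ∀ {P Q x} → R P Q → P ↓ⁱ x → Q ↓ⁱ x
      barbᵒ : ∀ {P Q x} → R P Q → P ↓ᵒ x → Q ↓ᵒ x
      step  : ∀ {P Q P′} → R P Q → P —[ τ ]→ P′ →
              ∃[ Q′ ] ((Q —[ τ ]→ Q′) × R P′ Q′)

  -- Strong barbed similarity.
  _≲_ : Rel Process (ℓsuc 0ℓ)
  P ≲ Q = Σ[ R ∈ Rel Process 0ℓ ] (IsStrongBarbedSimulation R × R P Q)

  data Context : Set where
    hole   : Context
    recvᶜ  : Name → Name → Context → Context
    sendᶜ  : Name → Name → Context → Context
    _∣ˡ_   : Context → Process → Context
    _∣ʳ_   : Process → Context → Context
    νᶜ     : Name → Context → Context
    !ᶜ_    : Context → Context

  -- The binders of a context are named, and may capture free names of the argument.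
  plug : Context → Process → Process
  plug hole          P = P
  plug (recvᶜ x y C) P = x ⦅ y ⦆∙ plug C P
  plug (sendᶜ x y C) P = x ⟨ y ⟩∙ plug C P
  plug (C ∣ˡ Q)      P = plug C P ∣ Q
  plug (Q ∣ʳ C)      P = Q ∣ plug C P
  plug (νᶜ x C)      P = ν⟨ x ⟩ plug C P
  plug (!ᶜ C)        P = ! plug C P

  _≤B_ : Rel Process (ℓsuc 0ℓ)
  P ≤B Q = ∀ C → plug C P ≲ plug C Q

  _≤∣s_ : Rel Process (ℓsuc 0ℓ)
  P ≤∣s Q = ∀ (R : Process) (σ : Subst) → (P ⟪ σ ⟫ ∣ R) ≲ (Q ⟪ σ ⟫ ∣ R)

{-# OPTIONS --safe #-}

-- The relation ≤∣s is preserved by every operator. Parallel composition and restriction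
-- follow from structural congruence (a bisimulation) and closure of similarity under ν;
-- for prefixes, the residual of a communication is an instance, under a substitution for
-- input, of the hypothesis. For ! P, a step of A ∣ ! P engages at most two copies of P,
-- and P ∣ P ∣ A is answered by some Q ∣ Q ∣ A. Similarity is not known to be preserved by
-- ∣, so to add ! P to both residuals the step is played next to a process that releases
-- ! P only after a handshake on a fresh name, which strong barbs force to come second.
-- The resulting simulation relates A ∣ ! P to A ∣ ! Q up to similarity with ! P on both
-- sides. Transitions are analysed in a presentation without bound names.

module Submission where

open import Defs

open import Data.Bool.Base using (if_then_else_)
open import Data.List.Base using (List; []; _∷_; _++_; [_])
open import Data.List.Membership.Propositional using (_∈_)
open import Data.List.Membership.Propositional.Properties using (∈-++⁺ˡ; ∈-++⁺ʳ)
open import Data.List.Relation.Unary.Any using (here; there)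
open import Data.Maybe.Base using (Maybe; just; nothing; maybe′; map)
open import Data.Product using (∃-syntax; _×_; _,_; proj₁; proj₂)
open import Data.Sum using (_⊎_; inj₁; inj₂; [_,_]′)
open import Function.Base using (id; _∘_)
open import Level using (0ℓ)
open import Relation.Binary using (Rel)
open import Relation.Binary.PropositionalEquality
  using (_≡_; _≢_; refl; sym; trans; cong; cong₂; subst; subst₂; ≢-sym)
open import Relation.Nullary using (yes; no; does; contradiction)
open import Relation.Unary using (_∉_; _⊥_)

private variable
  V W : Set
  P P′ Q Q′ R F : Proc V
  f g h k : V → W
  v w x y z : V

-- Renaming

map-∘ : (∀ v → g (f v) ≡ h v) → ∀ v → map g (map f v) ≡ map h v
map-∘ eq nothing  = refl
map-∘ eq (just v) = cong just (eq v)

-- Agreement is asked only on free names, because the freshness conditions met later control a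
-- renaming only there.
ren-cong-fn : (P : Proc V) → (∀ v → fn P v → f v ≡ g v) → ren f P ≡ ren g P
ren-cong-fn 𝟎            eq = refl
ren-cong-fn (recv x P)   eq = cong₂ recv (eq x (inj₁ refl))
  (ren-cong-fn P λ { nothing _ → refl ; (just v) v∈ → cong just (eq v (inj₂ v∈)) })
ren-cong-fn (send x y P) eq
  rewrite eq x (inj₁ refl) | eq y (inj₂ (inj₁ refl)) = cong (send _ _) (ren-cong-fn P λ v v∈ → eq v (inj₂ (inj₂ v∈)))
ren-cong-fn (P ∣ Q)      eq = cong₂ _∣_ (ren-cong-fn P λ v → eq v ∘ inj₁) (ren-cong-fn Q λ v → eq v ∘ inj₂)
ren-cong-fn (ν P)        eq =
  cong ν (ren-cong-fn P λ { nothing _ → refl ; (just v) v∈ → cong just (eq v v∈) })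
ren-cong-fn (! P)        eq = cong !_ (ren-cong-fn P eq)

ren-id : (P : Proc V) → ren id P ≡ P
ren-id-map : (P : Proc (Maybe V)) → ren (map id) P ≡ P
ren-id 𝟎            = refl
ren-id (recv x P)   = cong (recv x) (ren-id-map P)
ren-id (send x y P) = cong (send x y) (ren-id P)
ren-id (P ∣ Q)      = cong₂ _∣_ (ren-id P) (ren-id Q)
ren-id (ν P)        = cong ν (ren-id-map P)
ren-id (! P)        = cong !_ (ren-id P)
ren-id-map P = trans (ren-cong-fn P λ { nothing _ → refl ; (just _) _ → refl }) (ren-id P)

ren-∘ : (∀ v → g (f v) ≡ h v) → (P : Proc V) → ren g (ren f P) ≡ ren h P
ren-∘ eq 𝟎            = refl
ren-∘ eq (recv x P)   = cong₂ recv (eq x) (ren-∘ (map-∘ eq) P)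
ren-∘ eq (send x y P) rewrite eq x | eq y = cong (send _ _) (ren-∘ eq P)
ren-∘ eq (P ∣ Q)      = cong₂ _∣_ (ren-∘ eq P) (ren-∘ eq Q)
ren-∘ eq (ν P)        = cong ν (ren-∘ (map-∘ eq) P)
ren-∘ eq (! P)        = cong !_ (ren-∘ eq P)

ren-∘-fn : (P : Proc V) → (∀ v → fn P v → g (f v) ≡ h v) → ren g (ren f P) ≡ ren h P
ren-∘-fn P eq = trans (ren-∘ (λ _ → refl) P) (ren-cong-fn P eq)

ren-comm : (∀ v → g (f v) ≡ k (h v)) → (P : Proc V) → ren g (ren f P) ≡ ren k (ren h P)
ren-comm eq P = trans (ren-∘ eq P) (sym (ren-∘ (λ _ → refl) P))

ren-inv : (∀ v → g (f v) ≡ v) → (P : Proc V) → ren g (ren f P) ≡ P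
ren-inv eq P = trans (ren-∘ eq P) (ren-id P)

fn-ren⁻ : (P : Proc V) → fn (ren f P) w → ∃[ v ] (fn P v × f v ≡ w)
fn-ren-map⁻ : (P : Proc (Maybe V)) → fn (ren (map f) P) (just w) → ∃[ v ] (fn P (just v) × f v ≡ w)
fn-ren⁻ (recv x P)   (inj₁ refl)        = x , inj₁ refl , refl
fn-ren⁻ (recv x P)   (inj₂ w∈)          with v , v∈ , eq ← fn-ren-map⁻ P w∈ = v , inj₂ v∈ , eq
fn-ren⁻ (send x y P) (inj₁ refl)        = x , inj₁ refl , refl
fn-ren⁻ (send x y P) (inj₂ (inj₁ refl)) = y , inj₂ (inj₁ refl) , refl
fn-ren⁻ (send x y P) (inj₂ (inj₂ w∈))   with v , v∈ , eq ← fn-ren⁻ P w∈ = v , inj₂ (inj₂ v∈) , eq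
fn-ren⁻ (P ∣ Q)      (inj₁ w∈)          with v , v∈ , eq ← fn-ren⁻ P w∈ = v , inj₁ v∈ , eq
fn-ren⁻ (P ∣ Q)      (inj₂ w∈)          with v , v∈ , eq ← fn-ren⁻ Q w∈ = v , inj₂ v∈ , eq
fn-ren⁻ (ν P)        w∈                 = fn-ren-map⁻ P w∈
fn-ren⁻ (! P)        w∈                 = fn-ren⁻ P w∈
fn-ren-map⁻ P w∈ with fn-ren⁻ P w∈
... | just v , v∈ , refl = v , v∈ , refl

fn-ren⁺ : (P : Proc V) → fn P v → fn (ren f P) (f v)
fn-ren⁺ (recv x P)   (inj₁ refl)        = inj₁ refl
fn-ren⁺ (recv x P)   (inj₂ v∈)          = inj₂ (fn-ren⁺ P v∈)
fn-ren⁺ (send x y P) (inj₁ refl)        = inj₁ refl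
fn-ren⁺ (send x y P) (inj₂ (inj₁ refl)) = inj₂ (inj₁ refl)
fn-ren⁺ (send x y P) (inj₂ (inj₂ v∈))   = inj₂ (inj₂ (fn-ren⁺ P v∈))
fn-ren⁺ (P ∣ Q)      (inj₁ v∈)          = inj₁ (fn-ren⁺ P v∈)
fn-ren⁺ (P ∣ Q)      (inj₂ v∈)          = inj₂ (fn-ren⁺ Q v∈)
fn-ren⁺ (ν P)        v∈                 = fn-ren⁺ P v∈
fn-ren⁺ (! P)        v∈                 = fn-ren⁺ P v∈

-- Weakening, instantiation and exchange of bound names

infix 9 _⟦_⟧

wk : Proc V → Proc (Maybe V)
wk = ren just

_⟦_⟧ : Proc (Maybe V) → V → Proc V
F ⟦ y ⟧ = ren (maybe′ id y) F

-- In the residual of a bound action under `ν`, `nothing` is the transmitted name and `just nothing`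
-- the restricted one. Exchanging them lets `ν` bind the restricted name and leaves the transmitted
-- one outside.
swap : Maybe (Maybe V) → Maybe (Maybe V)
swap nothing         = just nothing
swap (just nothing)  = nothing
swap (just (just v)) = just (just v)

wk-inst : (P : Proc V) → wk P ⟦ y ⟧ ≡ P
wk-inst = ren-inv λ _ → refl

ren-wk : (f : V → W) (P : Proc V) → ren (map f) (wk P) ≡ wk (ren f P)
ren-wk f = ren-comm λ _ → refl

ren-inst : (f : V → W) (F : Proc (Maybe V)) → ren f (F ⟦ y ⟧) ≡ ren (map f) F ⟦ f y ⟧
ren-inst f = ren-comm λ { nothing → refl ; (just _) → refl }

ren-swap : (f : V → W) (F : Proc (Maybe (Maybe V))) →
           ren (map (map f)) (ren swap F) ≡ ren swap (ren (map (map f)) F)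
ren-swap f = ren-comm λ { nothing → refl ; (just nothing) → refl ; (just (just _)) → refl }

swap-swap : (F : Proc (Maybe (Maybe V))) → ren swap (ren swap F) ≡ F
swap-swap = ren-inv λ { nothing → refl ; (just nothing) → refl ; (just (just _)) → refl }

swap-wk : (F : Proc (Maybe V)) → ren swap (wk F) ≡ ren (map just) F
swap-wk = ren-∘ λ { nothing → refl ; (just _) → refl }

swap-map-just : (F : Proc (Maybe V)) → ren swap (ren (map just) F) ≡ wk F
swap-map-just = ren-∘ λ { nothing → refl ; (just _) → refl }

-- A transition system without bound names

data Free (V : Set) : Set where
  τ   : Free V
  out : (x y : V) → Free V

data Bind (V : Set) : Set where
  inp bout : (x : V) → Bind V

private variable
  α : Free V
  β : Bind V

mapᶠ : (V → W) → Free V → Free W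
mapᶠ f τ         = τ
mapᶠ f (out x y) = out (f x) (f y)

mapᵇ : (V → W) → Bind V → Bind W
mapᵇ f (inp x)  = inp (f x)
mapᵇ f (bout x) = bout (f x)

infix 4 _⟶⟨_⟩_ _⟶⦅_⦆_

-- The target of an input or a bound output is an abstraction of the transmitted name.
data _⟶⟨_⟩_ {V : Set} : Proc V → Free V → Proc V → Set
data _⟶⦅_⦆_ {V : Set} : Proc V → Bind V → Proc (Maybe V) → Set

data _⟶⟨_⟩_ where
  out      : send x y P ⟶⟨ out x y ⟩ P
  parˡ     : P ⟶⟨ α ⟩ P′ → P ∣ Q ⟶⟨ α ⟩ P′ ∣ Q
  parʳ     : Q ⟶⟨ α ⟩ Q′ → P ∣ Q ⟶⟨ α ⟩ P ∣ Q′
  comˡ     : P ⟶⟨ out x y ⟩ P′ → Q ⟶⦅ inp x ⦆ F → P ∣ Q ⟶⟨ τ ⟩ P′ ∣ F ⟦ y ⟧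
  comʳ     : P ⟶⦅ inp x ⦆ F → Q ⟶⟨ out x y ⟩ Q′ → P ∣ Q ⟶⟨ τ ⟩ F ⟦ y ⟧ ∣ Q′
  closeˡ   : P ⟶⦅ bout x ⦆ P′ → Q ⟶⦅ inp x ⦆ F → P ∣ Q ⟶⟨ τ ⟩ ν (P′ ∣ F)
  closeʳ   : P ⟶⦅ inp x ⦆ F → Q ⟶⦅ bout x ⦆ Q′ → P ∣ Q ⟶⟨ τ ⟩ ν (F ∣ Q′)
  res      : P ⟶⟨ mapᶠ just α ⟩ P′ → ν P ⟶⟨ α ⟩ ν P′
  rep      : P ⟶⟨ α ⟩ P′ → ! P ⟶⟨ α ⟩ P′ ∣ ! P
  repCom   : P ⟶⟨ out x y ⟩ P′ → P ⟶⦅ inp x ⦆ F → ! P ⟶⟨ τ ⟩ (P′ ∣ F ⟦ y ⟧) ∣ ! P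
  repClose : P ⟶⦅ bout x ⦆ P′ → P ⟶⦅ inp x ⦆ F → ! P ⟶⟨ τ ⟩ ν (P′ ∣ F) ∣ ! P

data _⟶⦅_⦆_ where
  inp  : recv x F ⟶⦅ inp x ⦆ F
  parˡ : P ⟶⦅ β ⦆ F → P ∣ Q ⟶⦅ β ⦆ F ∣ wk Q
  parʳ : Q ⟶⦅ β ⦆ F → P ∣ Q ⟶⦅ β ⦆ wk P ∣ F
  res  : P ⟶⦅ mapᵇ just β ⦆ F → ν P ⟶⦅ β ⦆ ν (ren swap F)
  open′ : P ⟶⟨ out (just x) nothing ⟩ P′ → ν P ⟶⦅ bout x ⦆ P′
  rep  : P ⟶⦅ β ⦆ F → ! P ⟶⦅ β ⦆ F ∣ wk (! P)

toᶠ : P′ ≡ Q′ → P ⟶⟨ α ⟩ P′ → P ⟶⟨ α ⟩ Q′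
toᶠ refl t = t

toᵇ : P′ ≡ Q′ → P ⟶⦅ β ⦆ P′ → P ⟶⦅ β ⦆ Q′
toᵇ refl t = t

relabelᶠ : ∀ {α α′} → α ≡ α′ → P ⟶⟨ α ⟩ P′ → P ⟶⟨ α′ ⟩ P′
relabelᶠ refl t = t

relabelᵇ : ∀ {β β′} → β ≡ β′ → P ⟶⦅ β ⦆ F → P ⟶⦅ β′ ⦆ F
relabelᵇ refl t = t

mapᶠ-∘ : (∀ v → g (f v) ≡ k (h v)) → ∀ α → mapᶠ g (mapᶠ f α) ≡ mapᶠ k (mapᶠ h α)
mapᶠ-∘ eq τ         = refl
mapᶠ-∘ eq (out x y) = cong₂ out (eq x) (eq y)

mapᵇ-∘ : (∀ v → g (f v) ≡ k (h v)) → ∀ β → mapᵇ g (mapᵇ f β) ≡ mapᵇ k (mapᵇ h β)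
mapᵇ-∘ eq (inp x)  = cong inp (eq x)
mapᵇ-∘ eq (bout x) = cong bout (eq x)

-- The calculus never tests names for being distinct, so identifying names may enable communications
-- but disables none.
renᶠ : (f : V → W) → P ⟶⟨ α ⟩ P′ → ren f P ⟶⟨ mapᶠ f α ⟩ ren f P′
renᵇ : (f : V → W) → P ⟶⦅ β ⦆ F → ren f P ⟶⦅ mapᵇ f β ⦆ ren (map f) F
renᶠ f out            = out
renᶠ f (parˡ t)       = parˡ (renᶠ f t)
renᶠ f (parʳ t)       = parʳ (renᶠ f t)
renᶠ f (comˡ {F = F} t u) = toᶠ (cong (_ ∣_) (sym (ren-inst f F))) (comˡ (renᶠ f t) (renᵇ f u))
renᶠ f (comʳ {F = F} t u) = toᶠ (cong (_∣ _) (sym (ren-inst f F))) (comʳ (renᵇ f t) (renᶠ f u))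
renᶠ f (closeˡ t u)   = closeˡ (renᵇ f t) (renᵇ f u)
renᶠ f (closeʳ t u)   = closeʳ (renᵇ f t) (renᵇ f u)
renᶠ f (res {α = α} t) = res (relabelᶠ (mapᶠ-∘ (λ _ → refl) α) (renᶠ (map f) t))
renᶠ f (rep t)        = rep (renᶠ f t)
renᶠ f (repCom {F = F} t u) = toᶠ (cong (λ G → (_ ∣ G) ∣ _) (sym (ren-inst f F))) (repCom (renᶠ f t) (renᵇ f u))
renᶠ f (repClose t u) = repClose (renᵇ f t) (renᵇ f u)
renᵇ f inp            = inp
renᵇ f (parˡ {Q = Q} t) = toᵇ (cong (_ ∣_) (sym (ren-wk f Q))) (parˡ (renᵇ f t))
renᵇ f (parʳ {P = P} t) = toᵇ (cong (_∣ _) (sym (ren-wk f P))) (parʳ (renᵇ f t))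
renᵇ f (res {β = β} {F = F} t) =
  toᵇ (cong ν (sym (ren-swap f F))) (res (relabelᵇ (mapᵇ-∘ (λ _ → refl) β) (renᵇ (map f) t)))
renᵇ f (open′ t)       = open′ (renᶠ (map f) t)
renᵇ f (rep {P = P} {F = F} t) = toᵇ (cong (ren (map f) F ∣_) (sym (ren-wk f (! P)))) (rep (renᵇ f t))

-- Free names along transitions

subject : Bind V → V
subject (inp x)  = x
subject (bout x) = x

subject-map : (f : V → W) → ∀ β → subject (mapᵇ f β) ≡ f (subject β)
subject-map f (inp x)  = refl
subject-map f (bout x) = refl

out-fn : P ⟶⟨ out x y ⟩ P′ → fn P x × fn P y
out-fn out      = inj₁ refl , inj₂ (inj₁ refl)
out-fn (parˡ t) = let x∈ , y∈ = out-fn t in inj₁ x∈ , inj₁ y∈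
out-fn (parʳ t) = let x∈ , y∈ = out-fn t in inj₂ x∈ , inj₂ y∈
out-fn (res t)  = out-fn t
out-fn (rep t)  = out-fn t

subject-fn : P ⟶⦅ β ⦆ F → fn P (subject β)
subject-fn inp       = inj₁ refl
subject-fn (parˡ t)  = inj₁ (subject-fn t)
subject-fn (parʳ t)  = inj₂ (subject-fn t)
subject-fn (res {P = P} {β = β} t) = subst (fn P) (subject-map just β) (subject-fn t)
subject-fn (open′ t) = proj₁ (out-fn t)
subject-fn (rep t)   = subject-fn t

fn-inst⁻ : (F : Proc (Maybe V)) → fn (F ⟦ y ⟧) v → y ≡ v ⊎ fn F (just v)
fn-inst⁻ F v∈ with fn-ren⁻ F v∈
... | nothing , _   , eq   = inj₁ eq
... | just _  , u∈  , refl = inj₂ u∈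

fn-wk⁻ : (P : Proc V) → fn (wk P) (just v) → fn P v
fn-wk⁻ P v∈ with _ , u∈ , refl ← fn-ren⁻ P v∈ = u∈

-- A communication adds only the transmitted name to the receiver, and that name is already free in
-- the sender. Hence a name fresh before a step is still fresh after it.
fnᶠ : P ⟶⟨ α ⟩ P′ → fn P′ v → fn P v
fnᵇ : P ⟶⦅ β ⦆ F → fn F (just v) → fn P v
fnᶠ out          v∈        = inj₂ (inj₂ v∈)
fnᶠ (parˡ t)     (inj₁ v∈) = inj₁ (fnᶠ t v∈)
fnᶠ (parˡ t)     (inj₂ v∈) = inj₂ v∈
fnᶠ (parʳ t)     (inj₁ v∈) = inj₁ v∈
fnᶠ (parʳ t)     (inj₂ v∈) = inj₂ (fnᶠ t v∈)
fnᶠ (comˡ t u)   (inj₁ v∈) = inj₁ (fnᶠ t v∈)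
fnᶠ (comˡ {F = F} t u) (inj₂ v∈) with fn-inst⁻ F v∈
... | inj₁ refl = inj₁ (proj₂ (out-fn t))
... | inj₂ v∈F  = inj₂ (fnᵇ u v∈F)
fnᶠ (comʳ {F = F} t u) (inj₁ v∈) with fn-inst⁻ F v∈
... | inj₁ refl = inj₂ (proj₂ (out-fn u))
... | inj₂ v∈F  = inj₁ (fnᵇ t v∈F)
fnᶠ (comʳ t u)   (inj₂ v∈) = inj₂ (fnᶠ u v∈)
fnᶠ (closeˡ t u) (inj₁ v∈) = inj₁ (fnᵇ t v∈)
fnᶠ (closeˡ t u) (inj₂ v∈) = inj₂ (fnᵇ u v∈)
fnᶠ (closeʳ t u) (inj₁ v∈) = inj₁ (fnᵇ t v∈)
fnᶠ (closeʳ t u) (inj₂ v∈) = inj₂ (fnᵇ u v∈)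
fnᶠ (res t)      v∈        = fnᶠ t v∈
fnᶠ (rep t)      (inj₁ v∈) = fnᶠ t v∈
fnᶠ (rep t)      (inj₂ v∈) = v∈
fnᶠ (repCom t u) (inj₁ (inj₁ v∈)) = fnᶠ t v∈
fnᶠ (repCom {F = F} t u) (inj₁ (inj₂ v∈)) with fn-inst⁻ F v∈
... | inj₁ refl = proj₂ (out-fn t)
... | inj₂ v∈F  = fnᵇ u v∈F
fnᶠ (repCom t u)   (inj₂ v∈)        = v∈
fnᶠ (repClose t u) (inj₁ (inj₁ v∈)) = fnᵇ t v∈
fnᶠ (repClose t u) (inj₁ (inj₂ v∈)) = fnᵇ u v∈
fnᶠ (repClose t u) (inj₂ v∈)        = v∈
fnᵇ inp          v∈        = inj₂ v∈
fnᵇ (parˡ t)     (inj₁ v∈) = inj₁ (fnᵇ t v∈)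
fnᵇ (parˡ {Q = Q} t) (inj₂ v∈) = inj₂ (fn-wk⁻ Q v∈)
fnᵇ (parʳ {P = P} t) (inj₁ v∈) = inj₁ (fn-wk⁻ P v∈)
fnᵇ (parʳ t)     (inj₂ v∈) = inj₂ (fnᵇ t v∈)
fnᵇ (res {F = F} t) v∈ with fn-ren⁻ F v∈
... | just (just _) , u∈ , refl = fnᵇ t u∈
fnᵇ (open′ t)    v∈        = fnᶠ t v∈
fnᵇ (rep t)      (inj₁ v∈) = fnᵇ t v∈
fnᵇ (rep {P = P} t) (inj₂ v∈) = fn-wk⁻ (! P) v∈

-- The point of V only serves to give just a left inverse.
reflectᶠ : V → ∀ {α R} (P : Proc V) → wk P ⟶⟨ α ⟩ R →
           ∃[ α′ ] ∃[ P′ ] (α ≡ mapᶠ just α′ × R ≡ wk P′ × P ⟶⟨ α′ ⟩ P′)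
reflectᶠ {V} v₀ {α} {R} P t =
  mapᶠ back α , ren back R , label α t , sym target ,
  subst (_⟶⟨ mapᶠ back α ⟩ ren back R) (wk-inst P) (renᶠ back t)
  where
  back : Maybe V → V
  back = maybe′ id v₀
  just-back : ∀ {v} → fn (wk P) v → just (back v) ≡ v
  just-back v∈ with _ , _ , refl ← fn-ren⁻ P v∈ = refl
  label : ∀ α → wk P ⟶⟨ α ⟩ R → α ≡ mapᶠ just (mapᶠ back α)
  label τ         t = refl
  label (out x y) t = let x∈ , y∈ = out-fn t in sym (cong₂ out (just-back x∈) (just-back y∈))
  -- By `fnᶠ` every free name of `R` is free in `wk P`, and on those names `just` also undoes
  -- `back`.
  target : wk (ren back R) ≡ R
  target = trans (ren-∘-fn R λ _ → just-back ∘ fnᶠ t) (ren-id R)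

reflectᵇ : V → ∀ {β R} (P : Proc V) → wk P ⟶⦅ β ⦆ R →
           ∃[ β′ ] ∃[ F ] (β ≡ mapᵇ just β′ × R ≡ ren (map just) F × P ⟶⦅ β′ ⦆ F)
reflectᵇ {V} v₀ {β} {R} P t =
  mapᵇ back β , ren (map back) R , label β (subject-fn t) , sym target ,
  subst (_⟶⦅ mapᵇ back β ⦆ ren (map back) R) (wk-inst P) (renᵇ back t)
  where
  back : Maybe V → V
  back = maybe′ id v₀
  just-back : ∀ {v} → fn (wk P) v → just (back v) ≡ v
  just-back v∈ with _ , _ , refl ← fn-ren⁻ P v∈ = refl
  label : ∀ β → fn (wk P) (subject β) → β ≡ mapᵇ just (mapᵇ back β)
  label (inp x)  x∈ = sym (cong inp (just-back x∈))
  label (bout x) x∈ = sym (cong bout (just-back x∈))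
  target : ren (map just) (ren (map back) R) ≡ R
  target = trans (ren-∘-fn R λ { nothing _ → refl ; (just _) v∈ → cong just (just-back (fnᵇ t v∈)) }) (ren-id R)

-- Structural congruence

infix  4 _≅_
infixr 6 _⨾_

-- The unusual law dead erases the signal that remains after the test in relay.
data _≅_ {V : Set} : Rel (Proc V) 0ℓ where
  ≡⇒≅      : P ≡ Q → P ≅ Q
  _⨾_      : P ≅ Q → Q ≅ R → P ≅ R
  comm     : P ∣ Q ≅ Q ∣ P
  assoc    : (P ∣ Q) ∣ R ≅ P ∣ (Q ∣ R)
  unit     : P ∣ 𝟎 ≅ P
  unit⁻    : P ≅ P ∣ 𝟎
  extrude  : ν P ∣ Q ≅ ν (P ∣ wk Q)
  extrude⁻ : ν (P ∣ wk Q) ≅ ν P ∣ Q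
  exchange : ν (ν P) ≅ ν (ν (ren swap P))
  unfold   : ! P ≅ P ∣ ! P
  fold     : P ∣ ! P ≅ ! P
  dead     : ν (send nothing nothing 𝟎) ≅ 𝟎
  dead⁻    : 𝟎 ≅ ν (send nothing nothing 𝟎)
  par      : P ≅ P′ → P ∣ Q ≅ P′ ∣ Q
  res      : P ≅ P′ → ν P ≅ ν P′

≅-refl : P ≅ P
≅-refl = ≡⇒≅ refl

parʳ-≅ : Q ≅ Q′ → P ∣ Q ≅ P ∣ Q′
parʳ-≅ e = comm ⨾ par e ⨾ comm

assoc⁻ : P ∣ (Q ∣ R) ≅ (P ∣ Q) ∣ R
assoc⁻ = comm ⨾ par comm ⨾ assoc ⨾ comm ⨾ par comm

extrudeʳ⁻ : ν (wk P ∣ Q) ≅ P ∣ ν Q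
extrudeʳ⁻ = res comm ⨾ extrude⁻ ⨾ comm

leftComm : P ∣ (Q ∣ R) ≅ Q ∣ (P ∣ R)
leftComm = assoc⁻ ⨾ par comm ⨾ assoc

exchange⁻ : {P : Proc (Maybe (Maybe V))} → ν (ν (ren swap P)) ≅ ν (ν P)
exchange⁻ {P = P} = exchange ⨾ ≡⇒≅ (cong (ν ∘ ν) (swap-swap P))

-- Symmetry is derived instead of being a constructor, so that the bisimulation proof treats each
-- constructor in one direction only.
≅-sym : P ≅ Q → Q ≅ P
≅-sym (≡⇒≅ eq) = ≡⇒≅ (sym eq)
≅-sym (d ⨾ e)  = ≅-sym e ⨾ ≅-sym d
≅-sym comm     = comm
≅-sym assoc    = assoc⁻
≅-sym unit     = unit⁻
≅-sym unit⁻    = unit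
≅-sym extrude  = extrude⁻
≅-sym extrude⁻ = extrude
≅-sym exchange = exchange⁻
≅-sym unfold   = fold
≅-sym fold     = unfold
≅-sym dead     = dead⁻
≅-sym dead⁻    = dead
≅-sym (par e)  = par (≅-sym e)
≅-sym (res e)  = res (≅-sym e)

ren-≅ : (f : V → W) → P ≅ Q → ren f P ≅ ren f Q
ren-≅ f (≡⇒≅ refl) = ≅-refl
ren-≅ f (d ⨾ e)    = ren-≅ f d ⨾ ren-≅ f e
ren-≅ f comm       = comm
ren-≅ f assoc      = assoc
ren-≅ f unit       = unit
ren-≅ f unit⁻      = unit⁻
ren-≅ f (extrude {Q = Q}) =
  extrude ⨾ ≡⇒≅ (cong (λ R → ν (_ ∣ R)) (sym (ren-wk f Q)))
ren-≅ f (extrude⁻ {Q = Q}) =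
  ≡⇒≅ (cong (λ R → ν (_ ∣ R)) (ren-wk f Q)) ⨾ extrude⁻
ren-≅ f (exchange {P = P}) =
  exchange ⨾ ≡⇒≅ (cong (ν ∘ ν) (sym (ren-swap f P)))
ren-≅ f unfold     = unfold
ren-≅ f fold       = fold
ren-≅ f dead       = dead
ren-≅ f dead⁻      = dead⁻
ren-≅ f (par e)    = par (ren-≅ f e)
ren-≅ f (res e)    = res (ren-≅ (map f) e)

wk-inst-≅ : (P : Proc V) → wk P ⟦ y ⟧ ≅ P
wk-inst-≅ P = ≡⇒≅ (wk-inst P)

-- Structural congruence is a bisimulation

infix 4 _⟶⟨_⟩≅_ _⟶⦅_⦆≅_

_⟶⟨_⟩≅_ : Proc V → Free V → Proc V → Set
P ⟶⟨ α ⟩≅ P′ = ∃[ Q ] ((P ⟶⟨ α ⟩ Q) × P′ ≅ Q)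

_⟶⦅_⦆≅_ : Proc V → Bind V → Proc (Maybe V) → Set
P ⟶⦅ β ⦆≅ F = ∃[ G ] ((P ⟶⦅ β ⦆ G) × F ≅ G)

extrudeᶠ : {P : Proc (Maybe V)} → ν P ∣ Q ⟶⟨ α ⟩ R → ν (P ∣ wk Q) ⟶⟨ α ⟩≅ R
extrudeᶠ (parˡ (res t)) = _ , res (parˡ t) , extrude
extrudeᶠ (parʳ t) = _ , res (parʳ (renᶠ just t)) , extrude
extrudeᶠ {Q = Q} (comˡ {y = y} {F = F} (res t) u) =
  _ , res (comˡ t (renᵇ just u)) , extrude ⨾ res (parʳ-≅ (≡⇒≅ (ren-inst just F)))
extrudeᶠ (comʳ (res {F = F} t) u) =
  _ , res (comʳ t (renᶠ just u)) ,
  extrude ⨾ res (par (≡⇒≅ (ren-∘ (λ { nothing → refl ; (just nothing) → refl ; (just (just _)) → refl }) F)))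
extrudeᶠ (closeˡ (res {F = F} t) u) =
  _ , res (closeˡ t (renᵇ just u)) ,
  res extrude ⨾ exchange ⨾ res (res (par (≡⇒≅ (swap-swap F)) ⨾ parʳ-≅ (≡⇒≅ (swap-wk _))))
-- The extruded name is the restricted one itself; with `Q` inside the scope this is a plain
-- communication of `nothing`.
extrudeᶠ (closeˡ {F = F} (open′ t) u) =
  _ , res (comˡ t (renᵇ just u)) ,
  res (parʳ-≅ (≡⇒≅ (sym (ren-inv (λ { nothing → refl ; (just _) → refl }) F))))
extrudeᶠ (closeʳ (res {F = F} t) u) =
  _ , res (closeʳ t (renᵇ just u)) ,
  res extrude ⨾ exchange ⨾ res (res (par (≡⇒≅ (swap-swap F)) ⨾ parʳ-≅ (≡⇒≅ (swap-wk _))))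

extrudeᵇ : {P : Proc (Maybe V)} → ν P ∣ Q ⟶⦅ β ⦆ F → ν (P ∣ wk Q) ⟶⦅ β ⦆≅ F
extrudeᵇ {Q = Q} (parˡ (res t)) =
  _ , res (parˡ t) , extrude ⨾ res (parʳ-≅ (≡⇒≅ (sym (trans (swap-wk (wk Q)) (ren-wk just Q)))))
extrudeᵇ (parˡ (open′ t)) = _ , open′ (parˡ t) , ≅-refl
extrudeᵇ {P = P} (parʳ {F = F} t) =
  _ , res (parʳ (renᵇ just t)) ,
  extrude ⨾ res (par (≡⇒≅ (sym (swap-wk P))) ⨾ parʳ-≅ (≡⇒≅ (sym (swap-map-just F))))

mapᵇ-just-injective : ∀ {β β′ : Bind V} → mapᵇ just β ≡ mapᵇ just β′ → β ≡ β′
mapᵇ-just-injective {β = inp _}  {inp _}  refl = refl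
mapᵇ-just-injective {β = bout _} {bout _} refl = refl

-- Steps of `wk Q` are pulled back to `Q` by reflection. The label is split into cases so that
-- `mapᶠ just α` computes and the step under `ν` can be analysed.
extrude⁻ᶠ : {P : Proc (Maybe V)} → V → ν (P ∣ wk Q) ⟶⟨ α ⟩ R → ν P ∣ Q ⟶⟨ α ⟩≅ R
extrude⁻ᶠ {α = out _ _} v₀ (res (parˡ t)) = _ , parˡ (res t) , extrude⁻
extrude⁻ᶠ {Q = Q} {α = out _ _} v₀ (res (parʳ t)) with reflectᶠ v₀ Q t
... | out _ _ , _ , refl , refl , t′ = _ , parʳ t′ , extrude⁻
extrude⁻ᶠ {α = τ} v₀ (res (parˡ t)) = _ , parˡ (res t) , extrude⁻
extrude⁻ᶠ {Q = Q} {α = τ} v₀ (res (parʳ t)) with reflectᶠ v₀ Q t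
... | τ , _ , refl , refl , t′ = _ , parʳ t′ , extrude⁻
-- The restricted name is transmitted to `Q`; with `Q` outside the scope, the communication becomes
-- a scope extrusion.
extrude⁻ᶠ {Q = Q} {α = τ} v₀ (res (comˡ {y = nothing} t u)) with reflectᵇ v₀ Q u
... | inp _ , F , refl , refl , u′ =
  _ , closeˡ (open′ t) u′ , res (parʳ-≅ (≡⇒≅ (ren-inv (λ { nothing → refl ; (just _) → refl }) F)))
extrude⁻ᶠ {Q = Q} {α = τ} v₀ (res (comˡ {y = just _} t u)) with reflectᵇ v₀ Q u
... | inp _ , F , refl , refl , u′ =
  _ , comˡ (res t) u′ , res (parʳ-≅ (≡⇒≅ (sym (ren-inst just F)))) ⨾ extrude⁻
extrude⁻ᶠ {Q = Q} {α = τ} v₀ (res (comʳ {F = F} t u)) with reflectᶠ v₀ Q u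
... | out _ _ , _ , refl , refl , u′ =
  _ , comʳ (res t) u′ ,
  res (par (≡⇒≅ (sym (ren-∘ (λ { nothing → refl ; (just nothing) → refl ; (just (just _)) → refl }) F)))) ⨾ extrude⁻
extrude⁻ᶠ {Q = Q} {α = τ} v₀ (res (closeˡ {P′ = P′} t u)) with reflectᵇ v₀ Q u
... | inp _ , F , refl , refl , u′ =
  _ , closeˡ (res t) u′ , exchange ⨾ res (res (parʳ-≅ (≡⇒≅ (swap-map-just F))) ⨾ extrude⁻)
extrude⁻ᶠ {Q = Q} {α = τ} v₀ (res (closeʳ t u)) with reflectᵇ v₀ Q u
... | bout _ , F , refl , refl , u′ =
  _ , closeʳ (res t) u′ , exchange ⨾ res (res (parʳ-≅ (≡⇒≅ (swap-map-just F))) ⨾ extrude⁻)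

extrude⁻ᵇ : {P : Proc (Maybe V)} → V → ν (P ∣ wk Q) ⟶⦅ β ⦆ F → ν P ∣ Q ⟶⦅ β ⦆≅ F
extrude⁻ᵇ {Q = Q} v₀ (res (parˡ t)) =
  _ , parˡ (res t) , res (parʳ-≅ (≡⇒≅ (trans (swap-wk (wk Q)) (ren-wk just Q)))) ⨾ extrude⁻
extrude⁻ᵇ {Q = Q} {P = P} v₀ (res (parʳ t)) with reflectᵇ v₀ Q t
... | _ , F , eq , refl , t′ with refl ← mapᵇ-just-injective eq =
  _ , parʳ t′ , res (par (≡⇒≅ (swap-wk P)) ⨾ parʳ-≅ (≡⇒≅ (swap-map-just F))) ⨾ extrude⁻
extrude⁻ᵇ v₀ (open′ (parˡ t)) = _ , parˡ (open′ t) , ≅-refl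
extrude⁻ᵇ {Q = Q} v₀ (open′ (parʳ t)) with reflectᶠ v₀ Q t
... | out _ _ , _ , () , _

swapᶠ : ∀ α → mapᶠ swap (mapᶠ just (mapᶠ {V} just α)) ≡ mapᶠ just (mapᶠ just α)
swapᶠ τ         = refl
swapᶠ (out _ _) = refl

-- The braid relation between adjacent transpositions, here of two restricted names and the
-- transmitted one.
braid : (F : Proc (Maybe (Maybe (Maybe V)))) →
        ren swap (ren (map swap) (ren swap F)) ≡ ren (map swap) (ren swap (ren (map swap) F))
braid F =
  trans (ren-∘ (λ _ → refl) (ren swap F))
  (trans (ren-comm (λ { nothing → refl ; (just nothing) → refl
                      ; (just (just nothing)) → refl ; (just (just (just _))) → refl }) F)
  (sym (ren-∘ (λ _ → refl) (ren (map swap) F))))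

exchangeᵇ : {P : Proc (Maybe (Maybe V))} → ν (ν P) ⟶⦅ β ⦆ F → ν (ν (ren swap P)) ⟶⦅ β ⦆≅ F
exchangeᵇ {β = inp _} (res (res {F = F} t)) =
  _ , res (res (renᵇ swap t)) , exchange ⨾ ≡⇒≅ (cong (ν ∘ ν) (braid F))
exchangeᵇ {β = bout _} (res (res {F = F} t)) =
  _ , res (res (renᵇ swap t)) , exchange ⨾ ≡⇒≅ (cong (ν ∘ ν) (braid F))
exchangeᵇ {β = bout _} (res (open′ t)) = _ , open′ (res (renᶠ swap t)) , ≅-refl
exchangeᵇ (open′ (res {P′ = P′} t)) =
  _ , res (open′ (renᶠ swap t)) , ≡⇒≅ (cong ν (sym (swap-swap P′)))

-- Each law regroups the components taking part in a step, or, for `dead`, relates processes without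
-- any step; induction on the congruence gives a step with the same label and a congruent residual.
-- The point `v₀` serves the reflection in the case `extrude⁻`; under a restriction `nothing` takes
-- its place.
matchᶠ : {P : Proc V} → V → P ≅ Q → P ⟶⟨ α ⟩ P′ → Q ⟶⟨ α ⟩≅ P′
matchᵇ : {P : Proc V} → V → P ≅ Q → P ⟶⦅ β ⦆ F → Q ⟶⦅ β ⦆≅ F
matchᶠ v₀ (≡⇒≅ refl) t = _ , t , ≅-refl
matchᶠ v₀ (d ⨾ e) t =
  let _ , t′ , d′ = matchᶠ v₀ d t ; _ , t″ , e′ = matchᶠ v₀ e t′ in _ , t″ , d′ ⨾ e′
matchᶠ v₀ comm (parˡ t)     = _ , parʳ t , comm
matchᶠ v₀ comm (parʳ t)     = _ , parˡ t , comm
matchᶠ v₀ comm (comˡ t u)   = _ , comʳ u t , comm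
matchᶠ v₀ comm (comʳ t u)   = _ , comˡ u t , comm
matchᶠ v₀ comm (closeˡ t u) = _ , closeʳ u t , res comm
matchᶠ v₀ comm (closeʳ t u) = _ , closeˡ u t , res comm
matchᶠ v₀ assoc (parˡ (parˡ t))     = _ , parˡ t , assoc
matchᶠ v₀ assoc (parˡ (parʳ t))     = _ , parʳ (parˡ t) , assoc
matchᶠ v₀ assoc (parʳ t)            = _ , parʳ (parʳ t) , assoc
matchᶠ v₀ (assoc {R = R}) (parˡ (comˡ t u)) =
  _ , comˡ t (parˡ u) , assoc ⨾ parʳ-≅ (parʳ-≅ (≅-sym (wk-inst-≅ R)))
matchᶠ v₀ assoc (parˡ (comʳ t u))   = _ , comʳ t (parˡ u) , assoc
matchᶠ v₀ assoc (parˡ (closeˡ t u)) = _ , closeˡ t (parˡ u) , extrude ⨾ res assoc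
matchᶠ v₀ assoc (parˡ (closeʳ t u)) = _ , closeʳ t (parˡ u) , extrude ⨾ res assoc
matchᶠ v₀ (assoc {Q = Q}) (comˡ (parˡ t) u) =
  _ , comˡ t (parʳ u) , assoc ⨾ parʳ-≅ (par (≅-sym (wk-inst-≅ Q)))
matchᶠ v₀ assoc (comˡ (parʳ t) u)   = _ , parʳ (comˡ t u) , assoc
matchᶠ v₀ (assoc {Q = Q}) (comʳ (parˡ t) u) =
  _ , comʳ t (parʳ u) , par (parʳ-≅ (wk-inst-≅ Q)) ⨾ assoc
matchᶠ v₀ (assoc {P = P}) (comʳ (parʳ t) u) =
  _ , parʳ (comʳ t u) , par (par (wk-inst-≅ P)) ⨾ assoc
matchᶠ v₀ assoc (closeˡ (parˡ t) u) = _ , closeˡ t (parʳ u) , res assoc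
matchᶠ v₀ assoc (closeˡ (parʳ t) u) = _ , parʳ (closeˡ t u) , res assoc ⨾ extrudeʳ⁻
matchᶠ v₀ assoc (closeʳ (parˡ t) u) = _ , closeʳ t (parʳ u) , res assoc
matchᶠ v₀ assoc (closeʳ (parʳ t) u) = _ , parʳ (closeʳ t u) , res assoc ⨾ extrudeʳ⁻
matchᶠ v₀ unit (parˡ t)     = _ , t , unit
matchᶠ v₀ unit (parʳ ())
matchᶠ v₀ unit (comˡ _ ())
matchᶠ v₀ unit (comʳ _ ())
matchᶠ v₀ unit (closeˡ _ ())
matchᶠ v₀ unit (closeʳ _ ())
matchᶠ v₀ unit⁻ t           = _ , parˡ t , unit⁻
matchᶠ v₀ extrude t         = extrudeᶠ t
matchᶠ v₀ extrude⁻ t        = extrude⁻ᶠ v₀ t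
matchᶠ {α = α} v₀ exchange (res (res t)) =
  _ , res (res (relabelᶠ (swapᶠ α) (renᶠ swap t))) , exchange
matchᶠ v₀ unfold (rep t)    = _ , parˡ t , ≅-refl
matchᶠ v₀ (unfold {P = P}) (repCom t u) =
  _ , comˡ t (rep u) , assoc ⨾ parʳ-≅ (parʳ-≅ (≅-sym (wk-inst-≅ (! P))))
matchᶠ v₀ unfold (repClose t u) = _ , closeˡ t (rep u) , extrude ⨾ res assoc
matchᶠ v₀ fold (parˡ t)     = _ , rep t , ≅-refl
matchᶠ v₀ fold (parʳ (rep t))        = _ , rep t , leftComm ⨾ parʳ-≅ fold
matchᶠ v₀ fold (parʳ (repCom t u))   = _ , repCom t u , leftComm ⨾ parʳ-≅ fold
matchᶠ v₀ fold (parʳ (repClose t u)) = _ , repClose t u , leftComm ⨾ parʳ-≅ fold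
-- The explicit copy communicates with one spawned by `! P`: two copies interact, which `! P` can do
-- by itself.
matchᶠ v₀ (fold {P = P}) (comˡ t (rep u)) =
  _ , repCom t u , parʳ-≅ (parʳ-≅ (wk-inst-≅ (! P))) ⨾ assoc⁻
matchᶠ v₀ fold (comʳ t (rep u))   = _ , repCom u t , assoc⁻ ⨾ par comm
matchᶠ v₀ fold (closeˡ t (rep u)) = _ , repClose t u , res assoc⁻ ⨾ extrude⁻
matchᶠ v₀ fold (closeʳ t (rep u)) = _ , repClose u t , res (assoc⁻ ⨾ par comm) ⨾ extrude⁻
matchᶠ {α = τ}       v₀ dead (res ())
matchᶠ {α = out _ _} v₀ dead (res ())
matchᶠ v₀ (par e) (parˡ t) = let _ , t′ , e′ = matchᶠ v₀ e t in _ , parˡ t′ , par e′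
matchᶠ v₀ (par e) (parʳ t) = _ , parʳ t , par e
matchᶠ v₀ (par e) (comˡ t u) = let _ , t′ , e′ = matchᶠ v₀ e t in _ , comˡ t′ u , par e′
matchᶠ v₀ (par e) (comʳ t u) = let _ , t′ , e′ = matchᵇ v₀ e t in _ , comʳ t′ u , par (ren-≅ _ e′)
matchᶠ v₀ (par e) (closeˡ t u) = let _ , t′ , e′ = matchᵇ v₀ e t in _ , closeˡ t′ u , res (par e′)
matchᶠ v₀ (par e) (closeʳ t u) = let _ , t′ , e′ = matchᵇ v₀ e t in _ , closeʳ t′ u , res (par e′)
matchᶠ v₀ (res e) (res t) = let _ , t′ , e′ = matchᶠ nothing e t in _ , res t′ , res e′
matchᵇ v₀ (≡⇒≅ refl) t = _ , t , ≅-refl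
matchᵇ v₀ (d ⨾ e) t =
  let _ , t′ , d′ = matchᵇ v₀ d t ; _ , t″ , e′ = matchᵇ v₀ e t′ in _ , t″ , d′ ⨾ e′
matchᵇ v₀ comm (parˡ t)         = _ , parʳ t , comm
matchᵇ v₀ comm (parʳ t)         = _ , parˡ t , comm
matchᵇ v₀ assoc (parˡ (parˡ t)) = _ , parˡ t , assoc
matchᵇ v₀ assoc (parˡ (parʳ t)) = _ , parʳ (parˡ t) , assoc
matchᵇ v₀ assoc (parʳ t)        = _ , parʳ (parʳ t) , assoc
matchᵇ v₀ unit (parˡ t)         = _ , t , unit
matchᵇ v₀ unit (parʳ ())
matchᵇ v₀ unit⁻ t               = _ , parˡ t , unit⁻
matchᵇ v₀ extrude t             = extrudeᵇ t
matchᵇ v₀ extrude⁻ t            = extrude⁻ᵇ v₀ t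
matchᵇ v₀ exchange t            = exchangeᵇ t
matchᵇ v₀ unfold (rep t)        = _ , parˡ t , ≅-refl
matchᵇ v₀ fold (parˡ t)         = _ , rep t , ≅-refl
matchᵇ v₀ fold (parʳ (rep t))   = _ , rep t , leftComm ⨾ parʳ-≅ fold
matchᵇ {β = inp _}  v₀ dead (res ())
matchᵇ {β = bout _} v₀ dead (res ())
matchᵇ v₀ dead (open′ ())
matchᵇ v₀ (par e) (parˡ t) = let _ , t′ , e′ = matchᵇ v₀ e t in _ , parˡ t′ , par e′
matchᵇ v₀ (par e) (parʳ t) = _ , parʳ t , par (ren-≅ just e)
matchᵇ v₀ (res e) (res t) =
  let _ , t′ , e′ = matchᵇ nothing e t in _ , res t′ , res (ren-≅ swap e′)
matchᵇ v₀ (res e) (open′ t) = let _ , t′ , e′ = matchᶠ nothing e t in _ , open′ t′ , e′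

-- Barbs

data Polarity : Set where
  receives sends : Polarity

private variable
  d : Polarity

data Barb {V : Set} (P : Proc V) : Polarity → V → Set where
  inp  : P ⟶⦅ inp x ⦆ F → Barb P receives x
  out  : P ⟶⟨ out x y ⟩ P′ → Barb P sends x
  bout : P ⟶⦅ bout x ⦆ F → Barb P sends x

barb-fn : Barb P d x → fn P x
barb-fn (inp t)  = subject-fn t
barb-fn (out t)  = proj₁ (out-fn t)
barb-fn (bout t) = subject-fn t

barb-≅ : {P : Proc V} → V → P ≅ Q → Barb P d x → Barb Q d x
barb-≅ v₀ e (inp t)  = inp (proj₁ (proj₂ (matchᵇ v₀ e t)))
barb-≅ v₀ e (out t)  = out (proj₁ (proj₂ (matchᶠ v₀ e t)))
barb-≅ v₀ e (bout t) = bout (proj₁ (proj₂ (matchᵇ v₀ e t)))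

barb-ren : (f : V → W) → Barb P d x → Barb (ren f P) d (f x)
barb-ren f (inp t)  = inp (renᵇ f t)
barb-ren f (out t)  = out (renᶠ f t)
barb-ren f (bout t) = bout (renᵇ f t)

barb-parˡ : Barb P d x → Barb (P ∣ Q) d x
barb-parˡ (inp t)  = inp (parˡ t)
barb-parˡ (out t)  = out (parˡ t)
barb-parˡ (bout t) = bout (parˡ t)

barb-parʳ : Barb Q d x → Barb (P ∣ Q) d x
barb-parʳ (inp t)  = inp (parʳ t)
barb-parʳ (out t)  = out (parʳ t)
barb-parʳ (bout t) = bout (parʳ t)

barb-par⁻ : Barb (P ∣ Q) d x → Barb P d x ⊎ Barb Q d x
barb-par⁻ (inp (parˡ t))  = inj₁ (inp t)
barb-par⁻ (inp (parʳ t))  = inj₂ (inp t)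
barb-par⁻ (out (parˡ t))  = inj₁ (out t)
barb-par⁻ (out (parʳ t))  = inj₂ (out t)
barb-par⁻ (bout (parˡ t)) = inj₁ (bout t)
barb-par⁻ (bout (parʳ t)) = inj₂ (bout t)

barb-ν : Barb P d (just x) → Barb (ν P) d x
barb-ν (inp t)                = inp (res t)
-- Sending the restricted name opens its scope but keeps the subject, so the barb survives as a
-- bound output.
barb-ν (out {y = nothing} t)  = bout (open′ t)
barb-ν (out {y = just _} t)   = out (res t)
barb-ν (bout t)               = bout (res t)

barb-ν⁻ : Barb (ν P) d x → Barb P d (just x)
barb-ν⁻ (inp (res t))    = inp t
barb-ν⁻ (out (res t))    = out t
barb-ν⁻ (bout (res t))   = bout t
barb-ν⁻ (bout (open′ t)) = out t

barb-! : Barb P d x → Barb (! P) d x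
barb-! (inp t)  = inp (rep t)
barb-! (out t)  = out (rep t)
barb-! (bout t) = bout (rep t)

barb-!⁻ : Barb (! P) d x → Barb P d x
barb-!⁻ (inp (rep t))  = inp t
barb-!⁻ (out (rep t))  = out t
barb-!⁻ (bout (rep t)) = bout t

-- Steps beside a replicated process

absorb : Q ∣ ! P ≅ (P ∣ Q) ∣ ! P
absorb = parʳ-≅ unfold ⨾ assoc⁻ ⨾ par comm

absorb₂ : Q ∣ ! P ≅ (P ∣ (P ∣ Q)) ∣ ! P
absorb₂ = absorb ⨾ absorb

-- Two copies move only in `repCom` and `repClose`; in all other cases at most one does. Copies that
-- stay idle are absorbed by `! P` again, so two explicit copies cover every case.
twoCopies : Q ∣ ! P ⟶⟨ τ ⟩ R → ∃[ R′ ] ((P ∣ (P ∣ Q) ⟶⟨ τ ⟩ R′) × R ≅ R′ ∣ ! P)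
twoCopies (parˡ t)                = _ , parʳ (parʳ t) , absorb₂
twoCopies (parʳ (rep t))          = _ , parʳ (parˡ t) , leftComm ⨾ assoc⁻ ⨾ absorb
twoCopies {Q = Q} (parʳ (repCom t u)) =
  _ , comˡ t (parˡ u) ,
  leftComm ⨾ assoc⁻ ⨾ par (assoc ⨾ parʳ-≅ (parʳ-≅ (≅-sym (wk-inst-≅ Q))))
twoCopies (parʳ (repClose t u))   =
  _ , closeˡ t (parˡ u) , leftComm ⨾ assoc⁻ ⨾ par (extrude ⨾ res assoc)
twoCopies {P = P} (comˡ t (rep u)) =
  _ , parʳ (comʳ u t) ,
  parʳ-≅ (parʳ-≅ (wk-inst-≅ (! P))) ⨾ leftComm ⨾ assoc⁻ ⨾ absorb
twoCopies (comʳ t (rep u))        = _ , parʳ (comˡ u t) , leftComm ⨾ assoc⁻ ⨾ absorb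
twoCopies (closeˡ t (rep u))      =
  _ , parʳ (closeʳ u t) , res (leftComm ⨾ assoc⁻) ⨾ extrude⁻ ⨾ absorb
twoCopies (closeʳ t (rep u))      =
  _ , parʳ (closeˡ u t) , res (leftComm ⨾ assoc⁻) ⨾ extrude⁻ ⨾ absorb

module ContextLemma (𝒩 : Names) where
  open Names 𝒩
  open Calculus 𝒩

  -- Fresh names and named abstraction

  names : (V → List Name) → Proc V → List Name
  names f 𝟎            = []
  names f (recv x P)   = f x ++ names (maybe′ f []) P
  names f (send x y P) = f x ++ f y ++ names f P
  names f (P ∣ Q)      = names f P ++ names f Q
  names f (ν P)        = names (maybe′ f []) P
  names f (! P)        = names f P

  -- The general `f` carries the induction under binders, where the bound variable contributes no
  -- names; `freshFor` takes `[_]`.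
  names-complete : (f : V → List Name) (P : Proc V) → fn P v → x ∈ f v → x ∈ names f P
  names-complete f (recv y P)   (inj₁ refl) x∈ = ∈-++⁺ˡ x∈
  names-complete f (recv y P)   (inj₂ v∈)   x∈ = ∈-++⁺ʳ (f y) (names-complete _ P v∈ x∈)
  names-complete f (send y z P) (inj₁ refl) x∈ = ∈-++⁺ˡ x∈
  names-complete f (send y z P) (inj₂ (inj₁ refl)) x∈ = ∈-++⁺ʳ (f y) (∈-++⁺ˡ x∈)
  names-complete f (send y z P) (inj₂ (inj₂ v∈)) x∈ =
    ∈-++⁺ʳ (f y) (∈-++⁺ʳ (f z) (names-complete f P v∈ x∈))
  names-complete f (P ∣ Q)      (inj₁ v∈)   x∈ = ∈-++⁺ˡ (names-complete f P v∈ x∈)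
  names-complete f (P ∣ Q)      (inj₂ v∈)   x∈ = ∈-++⁺ʳ (names f P) (names-complete f Q v∈ x∈)
  names-complete f (ν P)        v∈          x∈ = names-complete _ P v∈ x∈
  names-complete f (! P)        v∈          x∈ = names-complete f P v∈ x∈

  freshFor : (P : Process) → ∃[ z ] z ∉ fn P
  freshFor P with z , z∉ ← fresh (names [_] P) =
    z , λ z∈ → z∉ (names-complete [_] P z∈ (here refl))

  -- The renaming inside `abs`: `abs z` is `ren (capture z)` by definition, so results on renaming
  -- apply to it directly.
  capture : Name → Name → Maybe Name
  capture z w = if does (w ≟ z) then nothing else just w

  capture-self : ∀ z → capture z z ≡ nothing
  capture-self z with z ≟ z
  ... | yes _ = refl
  ... | no ¬p = contradiction refl ¬p

  capture-other : w ≢ z → capture z w ≡ just w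
  capture-other {w} {z} w≢z with w ≟ z
  ... | yes p = contradiction p w≢z
  ... | no _  = refl

  capture-just⁻ : ∀ {z w v} → capture z w ≡ just v → w ≡ v × v ≢ z
  capture-just⁻ {z} {w} eq with w ≟ z | eq
  ... | no w≢z | refl = refl , w≢z

  -- Distinct names can be bound in either order, up to the order of the two new indices.
  capture-swap : w ≢ z → ∀ v → swap (map (capture z) (capture w v)) ≡ map (capture w) (capture z v)
  capture-swap {w} {z} w≢z v with v ≟ w
  ... | yes refl rewrite capture-other w≢z | capture-self w = refl
  ... | no v≢w with v ≟ z
  ...   | yes refl = refl
  ...   | no v≢z rewrite capture-other v≢w = refl

  fn-abs⁻ : (P : Process) → fn (abs z P) (just v) → fn P v × v ≢ z
  fn-abs⁻ P v∈ with _ , u∈ , eq ← fn-ren⁻ P v∈ with refl , v≢z ← capture-just⁻ eq = u∈ , v≢z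

  -- Calling the bound variable `z` and then abstracting `z` recovers the binder, provided that no
  -- other free variable is called `z`.
  abs-ren : (F : Proc (Maybe V)) → (∀ v → fn F (just v) → f v ≢ z) →
            abs z (ren (maybe′ f z) F) ≡ ren (map f) F
  abs-ren F f≢z = ren-∘-fn F λ { nothing _ → capture-self _ ; (just v) v∈ → capture-other (f≢z v v∈) }

  abs-inst : (F : Proc (Maybe Name)) → (∀ v → fn F (just v) → v ≢ z) → abs z (F ⟦ z ⟧) ≡ F
  abs-inst F z∉ = trans (abs-ren F z∉) (ren-id-map F)

  abs-fresh : (P : Process) → z ∉ fn P → abs z P ≡ wk P
  abs-fresh P z∉ = ren-cong-fn P λ v v∈ → capture-other λ { refl → z∉ v∈ }

  inst-abs : (P : Process) → abs z P ⟦ y ⟧ ≡ P [ y / z ]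
  inst-abs {z} = ren-∘ λ w → pointwise w
    where
    pointwise : ∀ w → maybe′ id y (capture z w) ≡ (if does (w ≟ z) then y else w)
    pointwise w with w ≟ z
    ... | yes _ = refl
    ... | no _  = refl

  inst-abs-self : (P : Process) → abs z P ⟦ z ⟧ ≡ P
  inst-abs-self {z} = ren-inv pointwise
    where
    pointwise : ∀ w → maybe′ id z (capture z w) ≡ w
    pointwise w with w ≟ z
    ... | yes refl = refl
    ... | no _     = refl

  -- From named to nameless transitions

  bn-fresh : ∀ {α P P′} → P —[ α ]→ P′ → bn α ⊥ fn P
  bn-fresh (S-In z∉)      (refl , z∈)     = z∉ z∈
  bn-fresh (S-Par-L t p)  (b , inj₁ b∈)   = bn-fresh t (b , b∈)
  bn-fresh (S-Par-L t p)  (b , inj₂ b∈)   = p (b , b∈)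
  bn-fresh (S-Par-R t p)  (b , inj₁ b∈)   = p (b , b∈)
  bn-fresh (S-Par-R t p)  (b , inj₂ b∈)   = bn-fresh t (b , b∈)
  bn-fresh (S-Res {P = P} t z∉) (b , b∈)  = bn-fresh t (b , proj₁ (fn-abs⁻ P b∈))
  bn-fresh (S-Open {P = P} t z≢x) (refl , b∈) = proj₂ (fn-abs⁻ P b∈) refl
  bn-fresh (S-Rep t)      (b , b∈)        = bn-fresh t (b , b∈)

  Nameless : Process → Action → Process → Set
  Nameless P (input x z)    P′ = P ⟶⦅ inp x ⦆ abs z P′
  Nameless P (output x y)   P′ = P ⟶⟨ out x y ⟩ P′
  Nameless P (boundOut x z) P′ = P ⟶⦅ bout x ⦆ abs z P′
  Nameless P τ              P′ = P ⟶⟨ τ ⟩ P′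

  -- The case of `S-Res` for inputs and bound outputs: the restricted and the transmitted name are
  -- abstracted in opposite orders on the two sides, and the `swap` in the nameless rule makes up
  -- for it.
  abs-capture : ∀ {β} (P′ : Process) → w ≢ z → subject β ≢ z → P ⟶⦅ β ⦆ abs w P′ →
                ν⟨ z ⟩ P ⟶⦅ β ⦆ abs w (ν⟨ z ⟩ P′)
  abs-capture {w} {z} {β = β} P′ w≢z s≢z t =
    toᵇ (cong ν (trans (ren-∘ (λ _ → refl) (abs w P′)) (ren-comm (capture-swap w≢z) P′)))
        (res (relabelᵇ (label β s≢z) (renᵇ (capture z) t)))
    where
    label : ∀ β → subject β ≢ z → mapᵇ (capture z) β ≡ mapᵇ just β
    label (inp x)  x≢z = cong inp (capture-other x≢z)
    label (bout x) x≢z = cong bout (capture-other x≢z)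

  nameless : ∀ {α P P′} → P —[ α ]→ P′ → Nameless P α P′
  nameless (S-In _) = inp
  nameless S-Out = out
  nameless (S-Par-L {input x z} {Q = Q} t p) =
    toᵇ (cong (_ ∣_) (sym (abs-fresh Q λ z∈ → p (refl , z∈)))) (parˡ (nameless t))
  nameless (S-Par-L {output x y} t p) = parˡ (nameless t)
  nameless (S-Par-L {boundOut x z} {Q = Q} t p) =
    toᵇ (cong (_ ∣_) (sym (abs-fresh Q λ z∈ → p (refl , z∈)))) (parˡ (nameless t))
  nameless (S-Par-L {τ} t p) = parˡ (nameless t)
  nameless (S-Par-R {input x z} {P = P} t p) =
    toᵇ (cong (_∣ _) (sym (abs-fresh P λ z∈ → p (refl , z∈)))) (parʳ (nameless t))
  nameless (S-Par-R {output x y} t p) = parʳ (nameless t)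
  nameless (S-Par-R {boundOut x z} {P = P} t p) =
    toᵇ (cong (_∣ _) (sym (abs-fresh P λ z∈ → p (refl , z∈)))) (parʳ (nameless t))
  nameless (S-Par-R {τ} t p) = parʳ (nameless t)
  nameless (S-Com-L {Q′ = Q′} t u) = toᶠ (cong (_ ∣_) (inst-abs Q′)) (comˡ (nameless t) (nameless u))
  nameless (S-Com-R {P′ = P′} t u) = toᶠ (cong (_∣ _) (inst-abs P′)) (comʳ (nameless t) (nameless u))
  nameless (S-Res {input x w} {P′ = P′} t z∉) =
    abs-capture P′ (z∉ ∘ inj₂) (z∉ ∘ inj₁) (nameless t)
  nameless (S-Res {output x y} t z∉) =
    res (relabelᶠ
      (cong₂ out (capture-other (z∉ ∘ inj₁ ∘ inj₁)) (capture-other (z∉ ∘ inj₁ ∘ inj₂)))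
      (renᶠ (capture _) (nameless t)))
  nameless (S-Res {boundOut x w} {P′ = P′} t z∉) =
    abs-capture P′ (z∉ ∘ inj₂) (z∉ ∘ inj₁) (nameless t)
  nameless (S-Res {τ} t z∉) = res (renᶠ (capture _) (nameless t))
  nameless (S-Open {z = z} t z≢x) =
    open′ (relabelᶠ (cong₂ out (capture-other (≢-sym z≢x)) (capture-self z))
      (renᶠ (capture z) (nameless t)))
  nameless (S-Close-L t u) = closeˡ (nameless t) (nameless u)
  nameless (S-Close-R t u) = closeʳ (nameless t) (nameless u)
  -- `S-Rep` has no side condition; that `z` is fresh for the remaining `! P` comes from the
  -- convention on bound names.
  nameless (S-Rep {input x z} {P} {P′} t) =
    toᵇ (cong (abs z P′ ∣_) (sym (abs-fresh (! P) λ z∈ → bn-fresh t (refl , z∈)))) (rep (nameless t))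
  nameless (S-Rep {output x y} t) = rep (nameless t)
  nameless (S-Rep {boundOut x z} {P} {P′} t) =
    toᵇ (cong (abs z P′ ∣_) (sym (abs-fresh (! P) λ z∈ → bn-fresh t (refl , z∈)))) (rep (nameless t))
  nameless (S-Rep {τ} t) = rep (nameless t)
  nameless (S-Rep-Com {P″ = P″} t u) =
    toᶠ (cong (λ Q → (_ ∣ Q) ∣ _) (inst-abs P″)) (repCom (nameless t) (nameless u))
  nameless (S-Rep-Close t u) = repClose (nameless t) (nameless u)

  -- From nameless to named transitions

  nameᶠ : (V → Name) → Free V → Action
  nameᶠ f τ         = τ
  nameᶠ f (out x y) = output (f x) (f y)

  nameᵇ : (V → Name) → Bind V → Name → Action
  nameᵇ f (inp x)  z = input (f x) z
  nameᵇ f (bout x) z = boundOut (f x) z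

  bn-nameᵇ : ∀ (f : V → Name) β → bn (nameᵇ f β z) x → z ≡ x
  bn-nameᵇ f (inp _)  eq = eq
  bn-nameᵇ f (bout _) eq = eq

  bn-nameᶠ : ∀ (f : V → Name) α → x ∉ bn (nameᶠ f α)
  bn-nameᶠ f τ         ()
  bn-nameᶠ f (out _ _) ()

  avoid : (f : V → Name) (P : Proc V) → z ∉ fn (ren f P) → ∀ v → fn P v → f v ≢ z
  avoid f P z∉ v v∈ refl = z∉ (fn-ren⁺ P v∈)

  -- The fresh `z` is a temporary name of the bound variable, and the substitution of the
  -- communication rule replaces it at once.
  inst-[/] : (f : V → Name) (F : Proc (Maybe V)) → (∀ v → fn F (just v) → f v ≢ z) →
             ren (maybe′ f z) F [ f y / z ] ≡ ren f (F ⟦ y ⟧)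
  inst-[/] {z = z} {y} f F f≢z =
    trans (sym (inst-abs (ren (maybe′ f z) F)))
    (trans (cong _⟦ f y ⟧ (abs-ren F f≢z)) (sym (ren-inst f F)))

  toⁿ : ∀ {P P′ Q Q′ : Process} {α} → P ≡ Q → P′ ≡ Q′ → P —[ α ]→ P′ → Q —[ α ]→ Q′
  toⁿ refl refl t = t

  -- The statement is for an arbitrary naming `f` of the variables, so that the induction can enter
  -- a restriction with `maybe′ f z` for a fresh `z`.
  namedᶠ : P ⟶⟨ α ⟩ P′ → (f : V → Name) → ren f P —[ nameᶠ f α ]→ ren f P′
  namedᵇ : P ⟶⦅ β ⦆ F → (f : V → Name) → ∀ z → z ∉ fn (ren f P) →
           ren f P —[ nameᵇ f β z ]→ ren (maybe′ f z) F
  namedᶠ out f = S-Out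
  namedᶠ (parˡ {α = α} t) f = S-Par-L (namedᶠ t f) (bn-nameᶠ f α ∘ proj₁)
  namedᶠ (parʳ {α = α} t) f = S-Par-R (namedᶠ t f) (bn-nameᶠ f α ∘ proj₁)
  namedᶠ (comˡ {Q = Q} {F = F} t u) f with z , z∉ ← freshFor (ren f Q) =
    toⁿ refl (cong (_ ∣_) (inst-[/] f F λ v → avoid f Q z∉ v ∘ fnᵇ u))
      (S-Com-L (namedᶠ t f) (namedᵇ u f z z∉))
  namedᶠ (comʳ {P = P} {F = F} t u) f with z , z∉ ← freshFor (ren f P) =
    toⁿ refl (cong (_∣ _) (inst-[/] f F λ v → avoid f P z∉ v ∘ fnᵇ t))
      (S-Com-R (namedᵇ t f z z∉) (namedᶠ u f))
  namedᶠ (closeˡ {P = P} {P′ = P′} {Q = Q} {F = F} t u) f with z , z∉ ← freshFor (ren f (P ∣ Q)) =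
    toⁿ refl (cong ν (abs-ren (P′ ∣ F) λ v → avoid f (P ∣ Q) z∉ v ∘ [ inj₁ ∘ fnᵇ t , inj₂ ∘ fnᵇ u ]′))
      (S-Close-L (namedᵇ t f z (z∉ ∘ inj₁)) (namedᵇ u f z (z∉ ∘ inj₂)))
  namedᶠ (closeʳ {P = P} {F = F} {Q = Q} {Q′ = Q′} t u) f with z , z∉ ← freshFor (ren f (P ∣ Q)) =
    toⁿ refl (cong ν (abs-ren (F ∣ Q′) λ v → avoid f (P ∣ Q) z∉ v ∘ [ inj₁ ∘ fnᵇ t , inj₂ ∘ fnᵇ u ]′))
      (S-Close-R (namedᵇ t f z (z∉ ∘ inj₁)) (namedᵇ u f z (z∉ ∘ inj₂)))
  namedᶠ (res {P = P} {α = α} {P′ = P′} t) f with z , z∉ ← freshFor (ren f (ν P)) =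
    toⁿ (cong ν (abs-ren P (avoid f (ν P) z∉)))
        (cong ν (abs-ren P′ λ v → avoid f (ν P) z∉ v ∘ fnᶠ t))
      (S-Res (subst (_ —[_]→ _) (label α) (namedᶠ t (maybe′ f z))) (z∉α α t))
    where
    label : ∀ α → nameᶠ (maybe′ f z) (mapᶠ just α) ≡ nameᶠ f α
    label τ         = refl
    label (out _ _) = refl
    z∉α : ∀ α → P ⟶⟨ mapᶠ just α ⟩ P′ → z ∉ nᵃ (nameᶠ f α)
    z∉α (out x y) t (inj₁ (inj₁ eq)) = avoid f (ν P) z∉ x (proj₁ (out-fn t)) eq
    z∉α (out x y) t (inj₁ (inj₂ eq)) = avoid f (ν P) z∉ y (proj₂ (out-fn t)) eq
    z∉α τ         t (inj₁ ())
    z∉α τ         t (inj₂ ())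
  namedᶠ (rep t) f = S-Rep (namedᶠ t f)
  namedᶠ (repCom {P = P} {F = F} t u) f with z , z∉ ← freshFor (ren f P) =
    toⁿ refl (cong (λ Q → (_ ∣ Q) ∣ _) (inst-[/] f F λ v → avoid f P z∉ v ∘ fnᵇ u))
      (S-Rep-Com (namedᶠ t f) (namedᵇ u f z z∉))
  namedᶠ (repClose {P = P} {P′ = P′} {F = F} t u) f with z , z∉ ← freshFor (ren f P) =
    toⁿ refl (cong (λ Q → ν Q ∣ ! ren f P)
        (abs-ren (P′ ∣ F) λ v → avoid f P z∉ v ∘ [ fnᵇ t , fnᵇ u ]′))
      (S-Rep-Close (namedᵇ t f z z∉) (namedᵇ u f z z∉))
  namedᵇ (inp {x = x} {F = F}) f z z∉ =
    toⁿ eq refl (S-In (subst (λ P → z ∉ fn P) (sym eq) z∉))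
    where
    eq : f x ⦅ z ⦆∙ ren (maybe′ f z) F ≡ ren f (recv x F)
    eq = cong (recv _) (abs-ren F λ v → avoid f (recv x F) z∉ v ∘ inj₂)
  namedᵇ (parˡ {β = β} {Q = Q} t) f z z∉ =
    toⁿ refl (cong (_ ∣_) (sym (ren-∘ (λ _ → refl) Q)))
      (S-Par-L (namedᵇ t f z (z∉ ∘ inj₁))
        λ { (b , b∈) → z∉ (inj₂ (subst (fn (ren f Q)) (sym (bn-nameᵇ f β b)) b∈)) })
  namedᵇ (parʳ {β = β} {P = P} t) f z z∉ =
    toⁿ refl (cong (_∣ _) (sym (ren-∘ (λ _ → refl) P)))
      (S-Par-R (namedᵇ t f z (z∉ ∘ inj₂))
        λ { (b , b∈) → z∉ (inj₁ (subst (fn (ren f P)) (sym (bn-nameᵇ f β b)) b∈)) })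
  namedᵇ (res {P = P} {β = β} {F = F} t) f z z∉
    -- `w` names the restriction; the added `send z z 𝟎` keeps it apart from the transmitted name
    -- `z`.
    with w , w∉ ← freshFor (ren f (ν P) ∣ send z z 𝟎) =
    toⁿ (cong ν (abs-ren P f≢w)) (cong ν capture-w)
      (S-Res (subst (_ —[_]→ _) (label β) (namedᵇ t (maybe′ f w) z z∉P)) (w∉β β (subject-fn t)))
    where
    z≢w : z ≢ w
    z≢w z≡w = w∉ (inj₂ (inj₁ z≡w))
    f≢w : ∀ v → fn P (just v) → f v ≢ w
    f≢w = avoid f (ν P) (w∉ ∘ inj₁)
    z∉P : z ∉ fn (ren (maybe′ f w) P)
    z∉P z∈ with fn-ren⁻ P z∈
    ... | nothing , _  , w≡z = z≢w (sym w≡z)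
    ... | just v  , v∈ , f≡z = avoid f (ν P) z∉ v v∈ f≡z
    label : ∀ β → nameᵇ (maybe′ f w) (mapᵇ just β) z ≡ nameᵇ f β z
    label (inp _)  = refl
    label (bout _) = refl
    w∉β : ∀ β → fn P (subject (mapᵇ just β)) → w ∉ nᵃ (nameᵇ f β z)
    w∉β (inp x)  x∈ (inj₁ eq) = f≢w x x∈ eq
    w∉β (bout x) x∈ (inj₁ eq) = f≢w x x∈ eq
    w∉β (inp x)  x∈ (inj₂ eq) = z≢w eq
    w∉β (bout x) x∈ (inj₂ eq) = z≢w eq
    capture-w : abs w (ren (maybe′ (maybe′ f w) z) F) ≡ ren (map (maybe′ f z)) (ren swap F)
    capture-w = trans (ren-∘-fn F pointwise) (sym (ren-∘ (λ _ → refl) F))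
      where
      pointwise : ∀ v → fn F v → capture w (maybe′ (maybe′ f w) z v) ≡ map (maybe′ f z) (swap v)
      pointwise nothing         _  = capture-other z≢w
      pointwise (just nothing)  _  = capture-self w
      pointwise (just (just v)) v∈ = capture-other (f≢w v (fnᵇ t v∈))
  namedᵇ (open′ {P = P} {x = x} {P′ = P′} t) f z z∉ =
    toⁿ (cong ν (abs-ren P (avoid f (ν P) z∉))) refl
      (S-Open (namedᶠ t (maybe′ f z)) (≢-sym (avoid f (ν P) z∉ x (proj₁ (out-fn t)))))
  namedᵇ (rep {P = P} {F = F} t) f z z∉ =
    toⁿ refl (cong (ren (maybe′ f z) F ∣_) (sym (ren-∘ (λ _ → refl) (! P)))) (S-Rep (namedᵇ t f z z∉))

  -- Barbed simulation in nameless terms and up to closure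

  point : Name
  point = proj₁ (fresh [])

  ↓ⁱ⇒barb : {P : Process} → P ↓ⁱ x → Barb P receives x
  ↓ⁱ⇒barb (_ , _ , t) = inp (nameless t)

  ↓ᵒ⇒barb : {P : Process} → P ↓ᵒ x → Barb P sends x
  ↓ᵒ⇒barb (_ , _ , inj₁ t) = out (nameless t)
  ↓ᵒ⇒barb (_ , _ , inj₂ t) = bout (nameless t)

  named-τ : {P P′ : Process} → P ⟶⟨ τ ⟩ P′ → P —[ τ ]→ P′
  named-τ t = toⁿ (ren-id _) (ren-id _) (namedᶠ t id)

  barb⇒↓ⁱ : {P : Process} → Barb P receives x → P ↓ⁱ x
  barb⇒↓ⁱ {P = P} (inp t) with z , z∉ ← freshFor (ren id P) =
    z , _ , toⁿ (ren-id P) refl (namedᵇ t id z z∉)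

  barb⇒↓ᵒ : {P : Process} → Barb P sends x → P ↓ᵒ x
  barb⇒↓ᵒ {P = P} (out t) = _ , _ , inj₁ (toⁿ (ren-id P) refl (namedᶠ t id))
  barb⇒↓ᵒ {P = P} (bout t) with z , z∉ ← freshFor (ren id P) =
    z , _ , inj₂ (toⁿ (ren-id P) refl (namedᵇ t id z z∉))

  -- `T` says where the residuals may land: `Progress B B` is a barbed simulation,
  -- `Progress B (Closure B)` a simulation up to closure.
  record Progress (B T : Rel Process 0ℓ) : Set where
    field
      barb : ∀ {P Q x d} → B P Q → Barb P d x → Barb Q d x
      step : ∀ {P Q P′} → B P Q → P ⟶⟨ τ ⟩ P′ → ∃[ Q′ ] ((Q ⟶⟨ τ ⟩ Q′) × T P′ Q′)
  open Progress

  simulation⇒progress : ∀ {B} → IsStrongBarbedSimulation B → Progress B B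
  simulation⇒progress sim .barb {d = receives} b = ↓ⁱ⇒barb ∘ IsStrongBarbedSimulation.barbⁱ sim b ∘ barb⇒↓ⁱ
  simulation⇒progress sim .barb {d = sends}    b = ↓ᵒ⇒barb ∘ IsStrongBarbedSimulation.barbᵒ sim b ∘ barb⇒↓ᵒ
  simulation⇒progress sim .step b t =
    let _ , t′ , b′ = IsStrongBarbedSimulation.step sim b (named-τ t) in _ , nameless t′ , b′

  progress⇒simulation : ∀ {B} → Progress B B → IsStrongBarbedSimulation B
  progress⇒simulation p = record
    { barbⁱ = λ b → barb⇒↓ⁱ ∘ barb p b ∘ ↓ⁱ⇒barb
    ; barbᵒ = λ b → barb⇒↓ᵒ ∘ barb p b ∘ ↓ᵒ⇒barb
    ; step  = λ b t → let _ , t′ , b′ = step p b (nameless t) in _ , named-τ t′ , b′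
    }

  -- Transitivity is sound because a step is answered by exactly one step. Restriction is sound
  -- because a `τ` step of `ν P` is one of `P` and because restricting only hides barbs; its binder
  -- is named, as `B` relates processes over `Name`.
  data Closure (B : Rel Process 0ℓ) : Rel Process 0ℓ where
    base : ∀ {P Q} → B P Q → Closure B P Q
    iso  : ∀ {P Q} → P ≅ Q → Closure B P Q
    _⍮_  : ∀ {P Q R} → Closure B P Q → Closure B Q R → Closure B P R
    res  : ∀ {P Q} z → Closure B P Q → Closure B (ν⟨ z ⟩ P) (ν⟨ z ⟩ Q)

  infixr 6 _⍮_

  private variable
    B N S : Rel Process 0ℓ

  closure-barb : Progress B (Closure B) → ∀ {P Q} → Closure B P Q → Barb P d x → Barb Q d x
  closure-barb p (base b)  = barb p b
  closure-barb p (iso e)   = barb-≅ point e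
  closure-barb p (c ⍮ c′)  = closure-barb p c′ ∘ closure-barb p c
  closure-barb p (res {P} {Q} z c) b =
    let b′ = barb-ν⁻ b
        x≢z = proj₂ (fn-abs⁻ P (barb-fn b′))
    in barb-ν (subst (Barb _ _) (capture-other x≢z)
         (barb-ren (capture z) (closure-barb p c
           (subst (λ R → Barb R _ _) (inst-abs-self P) (barb-ren (maybe′ id z) b′)))))

  closure-step : Progress B (Closure B) → ∀ {P Q P′} → Closure B P Q → P ⟶⟨ τ ⟩ P′ →
                 ∃[ Q′ ] ((Q ⟶⟨ τ ⟩ Q′) × Closure B P′ Q′)
  closure-step p (base b) t = step p b t
  closure-step p (iso e)  t = let _ , t′ , e′ = matchᶠ point e t in _ , t′ , iso e′
  closure-step p (c ⍮ c′) t =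
    let _ , t₁ , c₁ = closure-step p c t
        _ , t₂ , c₂ = closure-step p c′ t₁
    in _ , t₂ , c₁ ⍮ c₂
  closure-step {B} p (res {P} {Q} z c) (res {P′ = P′} t) =
    -- Calling the bound variable `z` again turns the step of `abs z P` into one of `P`. As no free
    -- names arise, abstracting `z` from the residual undoes this.
    let t₀ = subst (_⟶⟨ τ ⟩ (P′ ⟦ z ⟧)) (inst-abs-self P) (renᶠ (maybe′ id z) t)
        _ , t₁ , c₁ = closure-step p c t₀
    in _ , res (renᶠ (capture z) t₁) ,
       iso (≡⇒≅ (cong ν (sym (abs-inst P′ λ _ → proj₂ ∘ fn-abs⁻ P ∘ fnᶠ t)))) ⍮ res z c₁

  closure-progress : Progress B (Closure B) → Progress (Closure B) (Closure B)
  closure-progress p .barb = closure-barb p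
  closure-progress p .step = closure-step p

  ⊆-closure : Progress B B → Progress B (Closure B)
  ⊆-closure p .barb = barb p
  ⊆-closure p .step b t = let _ , t′ , b′ = step p b t in _ , t′ , base b′

  infixr 5 _⊕_

  _⊕_ : Rel Process 0ℓ → Rel Process 0ℓ → Rel Process 0ℓ
  (B ⊕ N) P Q = B P Q ⊎ N P Q

  -- Adds new pairs `N` to a relation `S` already known to be a simulation, so that only the steps
  -- of `N` remain to be analysed.
  ⊕-progress : Progress S S → Progress N (Closure (S ⊕ N)) → Progress (S ⊕ N) (Closure (S ⊕ N))
  ⊕-progress p q .barb = [ barb p , barb q ]′
  ⊕-progress p q .step (inj₁ b) t = let _ , t′ , b′ = step p b t in _ , t′ , base (inj₁ b′)
  ⊕-progress p q .step (inj₂ b) t = step q b t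

  closure⇒≲ : Progress B (Closure B) → ∀ {P Q} → Closure B P Q → P ≲ Q
  closure⇒≲ p c = _ , progress⇒simulation (closure-progress p) , c

  -- Prefixes

  data Sends (x y : Name) (P Q : Process) : Rel Process 0ℓ where
    pair : ∀ R → Sends x y P Q (send x y P ∣ R) (send x y Q ∣ R)

  -- Until the prefix is consumed only the common `R` moves; a communication then leaves `P` and `Q`
  -- beside the same process, which is a pair of `S`.
  sends-progress : ∀ {P Q} → (∀ R → S (P ∣ R) (Q ∣ R)) → Progress (Sends x y P Q) (Closure (S ⊕ Sends x y P Q))
  sends-progress s .barb (pair R) b with barb-par⁻ b
  ... | inj₁ (out out) = barb-parˡ (out out)
  ... | inj₂ b         = barb-parʳ b
  sends-progress s .step (pair R) (parʳ t)     = _ , parʳ t , base (inj₂ (pair _))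
  sends-progress s .step (pair R) (comˡ out u) = _ , comˡ out u , base (inj₁ (s _))
  sends-progress s .step (pair R) (parˡ ())
  sends-progress s .step (pair R) (comʳ () _)
  sends-progress s .step (pair R) (closeˡ () _)
  sends-progress s .step (pair R) (closeʳ () _)

  data Recvs (x : Name) (F G : Proc (Maybe Name)) : Rel Process 0ℓ where
    pair : ∀ R → Recvs x F G (recv x F ∣ R) (recv x G ∣ R)

  recvs-progress : ∀ {F G} → (∀ z R → S (F ⟦ z ⟧ ∣ R) (G ⟦ z ⟧ ∣ R)) →
                   Progress (Recvs x F G) (Closure (S ⊕ Recvs x F G))
  recvs-progress s .barb (pair R) b with barb-par⁻ b
  ... | inj₁ (inp inp) = barb-parˡ (inp inp)
  ... | inj₂ b         = barb-parʳ b
  recvs-progress s .step (pair R) (parʳ t)     = _ , parʳ t , base (inj₂ (pair _))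
  recvs-progress s .step (pair R) (comʳ inp u) = _ , comʳ inp u , base (inj₁ (s _ _))
  recvs-progress {F = F} {G} s .step (pair R) (closeʳ {Q′ = R′} inp u)
    -- The received name is private to the sender. A fresh `z` stands for it, so that the hypothesis
    -- at `z` can be used inside a restriction of the closure.
    with z , z∉ ← freshFor (ν (F ∣ (G ∣ R′))) =
    _ , closeʳ inp u ,
    iso (≡⇒≅ (cong ν (sym (abs-inst (F ∣ R′) λ { _ v∈ refl → z∉ ([ inj₁ , inj₂ ∘ inj₂ ]′ v∈) }))))
    ⍮ res z (base (inj₁ (s z (R′ ⟦ z ⟧))))
    ⍮ iso (≡⇒≅ (cong ν (abs-inst (G ∣ R′) λ { _ v∈ refl → z∉ (inj₂ v∈) })))
  recvs-progress s .step (pair R) (parˡ ())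
  recvs-progress s .step (pair R) (comˡ () _)
  recvs-progress s .step (pair R) (closeˡ () _)

  -- Replication

  fired : (b : Name) → Process → Process
  fired b G = 𝟎 ∣ (b ⟨ b ⟩∙ 𝟎 ∣ G)

  -- Keeps `G` behind a handshake on `a`. For fresh `a` and `b`, the barbs on `a` show that the
  -- handshake is pending and the barb on `b` that it has happened.
  armed : (a b : Name) → Process → Process
  armed a b G = a ⟨ a ⟩∙ 𝟎 ∣ recv a (wk (b ⟨ b ⟩∙ 𝟎 ∣ G))

  fire : ∀ {a b} G → armed a b G ⟶⟨ τ ⟩ fired b G
  fire G = toᶠ (cong (λ P → 𝟎 ∣ (_ ∣ P)) (wk-inst G)) (comˡ out inp)

  -- Every action of the armed process has subject `a`, which `M` does not know, so the two cannot
  -- interact: either `M` moves alone or the handshake takes place.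
  step-armed : ∀ {a b G M D} → a ∉ fn M → M ∣ armed a b G ⟶⟨ τ ⟩ D →
               (∃[ M′ ] ((M ⟶⟨ τ ⟩ M′) × D ≡ M′ ∣ armed a b G)) ⊎ D ≡ M ∣ fired b G
  step-armed a∉ (parˡ t) = inj₁ (_ , t , refl)
  step-armed {G = G} a∉ (parʳ (comˡ out inp)) = inj₂ (cong (λ P → _ ∣ (𝟎 ∣ (_ ∣ P))) (wk-inst G))
  step-armed a∉ (parʳ (parˡ ()))
  step-armed a∉ (parʳ (parʳ ()))
  step-armed a∉ (parʳ (comʳ () _))
  step-armed a∉ (parʳ (closeˡ () _))
  step-armed a∉ (parʳ (closeʳ () _))
  step-armed a∉ (comˡ t (parʳ inp))   = contradiction (proj₁ (out-fn t)) a∉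
  step-armed a∉ (comˡ t (parˡ ()))
  step-armed a∉ (comʳ t (parˡ out))   = contradiction (subject-fn t) a∉
  step-armed a∉ (comʳ t (parʳ ()))
  step-armed a∉ (closeˡ t (parʳ inp)) = contradiction (subject-fn t) a∉
  step-armed a∉ (closeˡ t (parˡ ()))
  step-armed a∉ (closeʳ t (parˡ ()))
  step-armed a∉ (closeʳ t (parʳ ()))

  -- Restricting `b` confines it to the leftover signal, which `dead` erases.
  disarm : ∀ {b} P G → b ∉ fn P → b ∉ fn G → ν⟨ b ⟩ (P ∣ fired b G) ≅ P ∣ G
  disarm {b = b} P G b∉P b∉G
    rewrite abs-fresh P b∉P | abs-fresh G b∉G | capture-self b =
    extrudeʳ⁻ ⨾ parʳ-≅ (res (comm ⨾ unit) ⨾ extrude⁻ ⨾ par dead ⨾ comm ⨾ unit)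

  -- Testing with armed a b G for fresh a and b forces Q ∣ A to answer by itself: firing
  -- early loses the barb a, and once the left side has fired, only firing shows the
  -- barb b. Abstract, or the with-abstractions of reps-progress unfold it.
  abstract
    relay : Progress B (Closure B) → ∀ {P Q} → (∀ R → Closure B (P ∣ R) (Q ∣ R)) →
            ∀ A G {X} → P ∣ A ⟶⟨ τ ⟩ X →
            ∃[ Y ] ((Q ∣ A ⟶⟨ τ ⟩ Y) × Closure B (X ∣ G) (Y ∣ G))
    relay {B} p {P} {Q} c A G {X} t
      with a , a∉ ← freshFor (P ∣ (Q ∣ (A ∣ G)))
      -- The added prefix on `a` makes `b` differ from `a`.
      with b , b∉ ← freshFor (a ⟨ a ⟩∙ (P ∣ (Q ∣ (A ∣ G)))) = first first-step
      where
      K : Process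
      K = armed a b G
      a≢b : a ≢ b
      a≢b a≡b = b∉ (inj₁ a≡b)
      a∉QA : a ∉ fn (Q ∣ A)
      a∉QA = a∉ ∘ inj₂ ∘ [ inj₁ , inj₂ ∘ inj₁ ]′
      b∉′ : b ∉ fn (P ∣ (Q ∣ (A ∣ G)))
      b∉′ = b∉ ∘ inj₂ ∘ inj₂
      b∉QA : b ∉ fn (Q ∣ A)
      b∉QA = b∉′ ∘ inj₂ ∘ [ inj₁ , inj₂ ∘ inj₁ ]′
      b∉X : b ∉ fn X
      b∉X = b∉′ ∘ [ inj₁ , inj₂ ∘ inj₂ ∘ inj₁ ]′ ∘ fnᶠ t
      b∉G : b ∉ fn G
      b∉G = b∉′ ∘ inj₂ ∘ inj₂ ∘ inj₂

      first-step : ∃[ D ] (((Q ∣ A) ∣ K ⟶⟨ τ ⟩ D) × Closure B (X ∣ K) D)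
      first-step = closure-step p (iso assoc ⍮ c (A ∣ K) ⍮ iso assoc⁻) (parˡ t)

      second : ∀ {Y} → Q ∣ A ⟶⟨ τ ⟩ Y → ∃[ D ] ((Y ∣ K ⟶⟨ τ ⟩ D) × Closure B (X ∣ fired b G) D) →
               Closure B (X ∣ G) (Y ∣ G)
      second {Y} u (D , u′ , c′) with step-armed (a∉QA ∘ fnᶠ u) u′
      ... | inj₂ refl =
        iso (≅-sym (disarm X G b∉X b∉G)) ⍮ res b c′ ⍮ iso (disarm Y G (b∉QA ∘ fnᶠ u) b∉G)
      ... | inj₁ (_ , u″ , refl)
        with barb-par⁻ (closure-barb p c′ (barb-parʳ (barb-parʳ (barb-parˡ (out out)))))
      ...   | inj₁ d = contradiction (fnᶠ u (fnᶠ u″ (barb-fn d))) b∉QA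
      ...   | inj₂ d with barb-par⁻ d
      ...     | inj₁ (out out) = contradiction refl a≢b
      ...     | inj₂ (out ())
      ...     | inj₂ (bout ())

      first : ∃[ D ] (((Q ∣ A) ∣ K ⟶⟨ τ ⟩ D) × Closure B (X ∣ K) D) →
              ∃[ Y ] ((Q ∣ A ⟶⟨ τ ⟩ Y) × Closure B (X ∣ G) (Y ∣ G))
      first (D , u , c′) with step-armed a∉QA u
      ... | inj₁ (Y , u′ , refl) = Y , u′ , second u′ (closure-step p c′ (parʳ (fire G)))
      ... | inj₂ refl with barb-fn (closure-barb p c′ (barb-parʳ (barb-parʳ (inp inp))))
      ...   | inj₁ a∈                           = contradiction a∈ a∉QA
      ...   | inj₂ (inj₂ (inj₁ (inj₁ refl)))        = contradiction refl a≢b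
      ...   | inj₂ (inj₂ (inj₁ (inj₂ (inj₁ refl)))) = contradiction refl a≢b
      ...   | inj₂ (inj₂ (inj₂ a∈))             = contradiction (inj₂ (inj₂ (inj₂ a∈))) a∉

    match-τ : {P Q P′ : Process} → P ≅ Q → P ⟶⟨ τ ⟩ P′ → Q ⟶⟨ τ ⟩≅ P′
    match-τ = matchᶠ point

  data Reps (P Q : Process) : Rel Process 0ℓ where
    pair : ∀ A → Reps P Q (A ∣ ! P) (A ∣ ! Q)

  reps-progress : Progress B (Closure B) → ∀ {P Q} → (∀ R → Closure B (P ∣ R) (Q ∣ R)) →
                  Progress (Reps P Q) (Closure (Closure B ⊕ Reps P Q))
  reps-progress p c .barb (pair A) b with barb-par⁻ b
  ... | inj₁ b = barb-parˡ b
  ... | inj₂ b with barb-par⁻ (closure-barb p (c 𝟎) (barb-parˡ (barb-!⁻ b)))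
  ...   | inj₁ b′ = barb-parʳ (barb-! b′)
  ...   | inj₂ (inp ())
  ...   | inj₂ (out ())
  ...   | inj₂ (bout ())
  reps-progress p {P} {Q} c .step (pair A) t
    with _ , t₀ , e₀ ← twoCopies t
    -- The two copies of `P` are exchanged for `Q` one at a time, with `! P` as the process held
    -- back by the test.
    with _ , t₁ , c₁ ← relay p c (P ∣ A) (! P) t₀
    with _ , t₁′ , e₁ ← match-τ leftComm t₁
    with R₂ , t₂ , c₂ ← relay p c (Q ∣ A) (! P) t₁′
    with _ , t₃ , e₃ ← match-τ (≅-sym absorb₂) (parˡ {Q = ! Q} t₂) =
    -- Both relays keep `! P`; it is exchanged for `! Q` only by the new pair at `R₂`.
    _ , t₃ , iso e₀ ⍮ base (inj₁ (c₁ ⍮ iso (par e₁) ⍮ c₂)) ⍮ base (inj₂ (pair R₂)) ⍮ iso e₃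

  -- Congruence

  -- The union of the simulations witnessing all instances of the hypothesis. Similarity itself
  -- lives one universe higher and cannot serve as a simulation.
  Family : ∀ {P Q} → P ≤∣s Q → Rel Process 0ℓ
  Family h X Y = ∃[ R ] ∃[ σ ] proj₁ (h R σ) X Y

  family-progress : ∀ {P Q} (h : P ≤∣s Q) → Progress (Family h) (Family h)
  family-progress h .barb (R , σ , b) = barb (simulation⇒progress (proj₁ (proj₂ (h R σ)))) b
  family-progress h .step (R , σ , b) t =
    let _ , t′ , b′ = step (simulation⇒progress (proj₁ (proj₂ (h R σ)))) b t
    in _ , t′ , R , σ , b′

  family : ∀ {P Q} (h : P ≤∣s Q) σ R → Family h (P ⟪ σ ⟫ ∣ R) (Q ⟪ σ ⟫ ∣ R)
  family h σ R = R , σ , proj₂ (proj₂ (h R σ))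

  infixl 9 _,_↦_

  _,_↦_ : Subst → Name → Name → Subst
  σ , y ↦ z = record
    { apply   = λ w → if does (w ≟ y) then z else Subst.apply σ w
    ; support = y ∷ Subst.support σ
    ; finite  = finite
    }
    where
    finite : ∀ w → _ → (if does (w ≟ y) then z else Subst.apply σ w) ≡ w
    finite w w∉ with w ≟ y
    ... | yes refl = contradiction (here refl) w∉
    ... | no _     = Subst.finite σ w (w∉ ∘ there)

  idₛ : Subst
  idₛ = record { apply = id ; support = [] ; finite = λ _ _ → refl }

  abs-subst-inst : ∀ σ (P : Process) → ren (map (Subst.apply σ)) (abs y P) ⟦ z ⟧ ≡ P ⟪ σ , y ↦ z ⟫
  abs-subst-inst {y} {z} σ P =
    trans (ren-∘ {h = maybe′ (Subst.apply σ) z} (λ { nothing → refl ; (just _) → refl }) (abs y P))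
          (ren-∘ pointwise P)
    where
    pointwise : ∀ w → maybe′ (Subst.apply σ) z (capture y w) ≡ Subst.apply (σ , y ↦ z) w
    pointwise w with w ≟ y
    ... | yes _ = refl
    ... | no _  = refl

  abs-subst : ∀ σ (P : Process) → z ∉ fn ((ν⟨ x ⟩ P) ⟪ σ ⟫) →
              (ν⟨ x ⟩ P) ⟪ σ ⟫ ≡ ν⟨ z ⟩ (P ⟪ σ , x ↦ z ⟫)
  abs-subst {z} {x} σ P z∉ =
    cong ν (sym (trans (cong (abs z) (sym (abs-subst-inst σ P))) (abs-inst _ λ { _ v∈ refl → z∉ v∈ })))

  -- After receiving `z`, the continuation under `σ` is the instance of the hypothesis at
  -- `σ , y ↦ z`.
  ≤∣s-recv : ∀ {P Q} x y → P ≤∣s Q → (x ⦅ y ⦆∙ P) ≤∣s (x ⦅ y ⦆∙ Q)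
  ≤∣s-recv {P} {Q} x y h R σ =
    closure⇒≲ (⊕-progress (family-progress h) (recvs-progress instances)) (base (inj₂ (pair R)))
    where
    instances : ∀ z R → Family h _ _
    instances z R = subst₂ (λ P Q → Family h (P ∣ R) (Q ∣ R))
      (sym (abs-subst-inst σ P)) (sym (abs-subst-inst σ Q)) (family h (σ , y ↦ z) R)

  ≤∣s-send : ∀ {P Q} x y → P ≤∣s Q → (x ⟨ y ⟩∙ P) ≤∣s (x ⟨ y ⟩∙ Q)
  ≤∣s-send x y h R σ =
    closure⇒≲ (⊕-progress (family-progress h) (sends-progress (family h σ))) (base (inj₂ (pair R)))

  ≤∣s-parˡ : ∀ {P Q} T → P ≤∣s Q → (P ∣ T) ≤∣s (Q ∣ T)
  ≤∣s-parˡ T h R σ = closure⇒≲ (⊆-closure (family-progress h))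
    (iso assoc ⍮ base (family h σ (T ⟪ σ ⟫ ∣ R)) ⍮ iso assoc⁻)

  ≤∣s-parʳ : ∀ {P Q} T → P ≤∣s Q → (T ∣ P) ≤∣s (T ∣ Q)
  ≤∣s-parʳ T h R σ = closure⇒≲ (⊆-closure (family-progress h))
    (iso (assoc ⨾ leftComm) ⍮ base (family h σ (T ⟪ σ ⟫ ∣ R)) ⍮ iso (leftComm ⨾ assoc⁻))

  -- With a fresh name for the binder, the restriction extends over `R`, and closure under
  -- restriction applies to the hypothesis at `σ , x ↦ z`.
  ≤∣s-ν : ∀ {P Q} x → P ≤∣s Q → (ν⟨ x ⟩ P) ≤∣s (ν⟨ x ⟩ Q)
  ≤∣s-ν {P} {Q} x h R σ with z , z∉ ← freshFor ((ν⟨ x ⟩ P) ⟪ σ ⟫ ∣ ((ν⟨ x ⟩ Q) ⟪ σ ⟫ ∣ R)) =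
    closure⇒≲ (⊆-closure (family-progress h))
      (iso (scope P (z∉ ∘ inj₁)) ⍮ res z (base (family h (σ , x ↦ z) R))
       ⍮ iso (≅-sym (scope Q (z∉ ∘ inj₂ ∘ inj₁))))
    where
    scope : ∀ P → z ∉ fn ((ν⟨ x ⟩ P) ⟪ σ ⟫) → (ν⟨ x ⟩ P) ⟪ σ ⟫ ∣ R ≅ ν⟨ z ⟩ (P ⟪ σ , x ↦ z ⟫ ∣ R)
    scope P z∉P = par (≡⇒≅ (abs-subst σ P z∉P)) ⨾ extrude
      ⨾ ≡⇒≅ (cong (λ R → ν (_ ∣ R)) (sym (abs-fresh R (z∉ ∘ inj₂ ∘ inj₂))))

  ≤∣s-! : ∀ {P Q} → P ≤∣s Q → (! P) ≤∣s (! Q)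
  ≤∣s-! h R σ =
    closure⇒≲ (⊕-progress (closure-progress p) (reps-progress p (base ∘ family h σ)))
      (iso comm ⍮ base (inj₂ (pair R)) ⍮ iso comm)
    where
    p = ⊆-closure (family-progress h)

  ≤∣s-plug : ∀ {P Q} C → P ≤∣s Q → plug C P ≤∣s plug C Q
  ≤∣s-plug hole          h = h
  ≤∣s-plug (recvᶜ x y C) h = ≤∣s-recv x y (≤∣s-plug C h)
  ≤∣s-plug (sendᶜ x y C) h = ≤∣s-send x y (≤∣s-plug C h)
  ≤∣s-plug (C ∣ˡ T)      h = ≤∣s-parˡ T (≤∣s-plug C h)
  ≤∣s-plug (T ∣ʳ C)      h = ≤∣s-parʳ T (≤∣s-plug C h)
  ≤∣s-plug (νᶜ x C)      h = ≤∣s-ν x (≤∣s-plug C h)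
  ≤∣s-plug (!ᶜ C)        h = ≤∣s-! (≤∣s-plug C h)

  ≤∣s⇒≲ : ∀ {P Q} → P ≤∣s Q → P ≲ Q
  ≤∣s⇒≲ {P} {Q} h = closure⇒≲ (⊆-closure (family-progress h))
    (iso (≅-sym (unit-id P)) ⍮ base (family h idₛ 𝟎) ⍮ iso (unit-id Q))
    where
    unit-id : ∀ P → P ⟪ idₛ ⟫ ∣ 𝟎 ≅ P
    unit-id P = unit ⨾ ≡⇒≅ (ren-id P)

theorem4p1 : (𝒩 : Names) → let open Calculus 𝒩 in
    ∀ (P Q : Process) → P ≤∣s Q → P ≤B Q
theorem4p1 𝒩 P Q h C = ≤∣s⇒≲ (≤∣s-plug C h)
  where open ContextLemma 𝒩
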